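{- (a) For every integer $k\ge 0$ and every real $r\ge 0$, there exist $L,C$ such that if a graph $G$ admits a tree-decomposition $(T,(B_t:t\in V(T)))$ such that for each $t\in V(T)$, $B_t$ is the union of at most $k$ sets each with diameter at most $r$ in $G$, then $G$ admits an $(L,C)$-quasi-isometry to a graph with pseudo-tree-width at most $k$. (b) Conversely, for every integer $k\ge 0$ and all $L,C\ge 1$, if a graph $G$ admits an $(L,C)$-quasi-isometry to a graph with pseudo-tree-width at most $k$, then $G$ admits a tree-decomposition $(T,(B_t:t\in V(T)))$ such that for each $t\in V(T)$, $B_t$ is the union of at most $k$ sets each of diameter at most $2L(L+C)+C$ in $G$.
   Context: Graphs may be infinite, and need not be connected. $\dist_G(u,v)$ is the number of edges in a shortest path of $G$ between $u,v$ ($\infty$ if there is none). The diameter of $X\subseteq V(G)$ in $G$ is the maximum of $\dist_G(u,v)$ over all $u,v\in X$ (distances are measured in $G$, not in $G[X]$). For $L,C\ge 0$, a map $\phi:V(G)\to V(H)$ is an $(L,C)$-quasi-isometry from $G$ to $H$ if: (i) for all $u,v\in V(G)$, if $\dist_G(u,v)$ is finite then $\dist_H(\phi(u),\phi(v))\le L\dist_G(u,v)+C$; (ii) for all $u,v\in V(G)$, if $\dist_H(\phi(u),\phi(v))$ is finite then $\dist_G(u,v)\le L\dist_H(\phi(u),\phi(v))+C$; (iii) for every $y\in V(H)$ there exists $v\in V(G)$ with $\dist_H(\phi(v),y)\le C$. "$G$ admits an $(L,C)$-quasi-isometry to $H$" means such a $\phi$ exists. A tree-decomposition of $G$ is a pair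 $(T,(B_t:t\in V(T)))$ where $T$ is a (possibly infinite) tree and each $B_t\subseteq V(G)$, such that $G$ is the union of the graphs $G[B_t]$ $(t\in V(T))$ and $B_{t_1}\cap B_{t_3}\subseteq B_{t_2}$ whenever $t_2$ lies on the path of $T$ between $t_1,t_3$. A pseudo-tree-decomposition of $G$ is a pair $(T,(B_t:t\in V(T)))$ where $T$ is a (possibly infinite) tree and each $B_t\subseteq V(G)$, such that: $V(G)=\bigcup_{t\in V(T)}B_t$; for every edge $uv$ of $G$, either there exists $t\in V(T)$ with $u,v\in B_t$, or there is an edge $st\in E(T)$ with $B_s\setminus B_t=\{u\}$ and $B_t\setminus B_s=\{v\}$; and $B_{t_1}\cap B_{t_3}\subseteq B_{t_2}$ whenever $t_2$ lies on the path of $T$ between $t_1,t_3$. Its width is the maximum of $|B_t|$ over $t\in V(T)$ (with no $-1$), or $\infty$ if there is no finite maximum; the pseudo-tree-width of $G$ is the minimum width of a pseudo-tree-decomposition of $G$. -}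

module Defs where

open import Algebra.Bundles using (CommutativeRing)
import Algebra.Definitions.RawMonoid as RawMonoidDefs
open import Data.Fin.Base using (Fin)
open import Data.List.Base using (List; []; _∷_; length)
import Data.List.Membership.Propositional as List
open import Data.List.Relation.Unary.Unique.Propositional using (Unique)
open import Data.Nat.Base as ℕ using (ℕ; zero; suc)
open import Data.Product.Base using (Σ-syntax; ∃; ∃-syntax; _×_)
open import Data.Sum.Base using (_⊎_)
open import Function.Bundles using (_⇔_)
open import Level using (0ℓ) renaming (suc to lsuc)
open import Relation.Binary.Core using (Rel)
open import Relation.Binary.Construct.Closure.ReflexiveTransitive using (Star; ε; _◅_)
open import Relation.Binary.Definitions using (Irreflexive; Symmetric)
open import Relation.Binary.PropositionalEquality.Core using (_≡_)
open import Relation.Binary.Structures using (IsTotalOrder)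
open import Relation.Nullary.Negation.Core using (¬_)
open import Relation.Unary using (Pred; _∈_; _≐_; _∖_; ｛_｝; ⋃; Satisfiable)

-- The library has no real numbers, so ℝ is given by its axioms, as a
-- Dedekind-complete totally ordered field.  Up to isomorphism there is only
-- one such field.  Equality is the setoid equality _≈_, so representations by
-- Cauchy sequences or cuts are admissible models.
record RealField : Set₁ where
  field
    commutativeRing : CommutativeRing 0ℓ 0ℓ

  open CommutativeRing commutativeRing public
    using (Carrier; _≈_; _+_; _*_; -_; 0#; 1#; +-rawMonoid)

  infix 4 _≤_
  field
    _≤_          : Rel Carrier 0ℓ
    isTotalOrder : IsTotalOrder _≈_ _≤_
    0≉1          : ¬ (0# ≈ 1#)
    inverse      : ∀ x → ¬ (x ≈ 0#) → ∃[ y ] x * y ≈ 1#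
    +-monoʳ-≤    : ∀ x {y z} → y ≤ z → x + y ≤ x + z
    *-nonNeg     : ∀ {x y} → 0# ≤ x → 0# ≤ y → 0# ≤ x * y

  UpperBound : Pred Carrier 0ℓ → Pred Carrier 0ℓ
  UpperBound S b = ∀ x → x ∈ S → x ≤ b

  field
    supremum : (S : Pred Carrier 0ℓ) → Satisfiable S → Satisfiable (UpperBound S) →
               ∃[ s ] (UpperBound S s × (∀ b → UpperBound S b → s ≤ b))

  fromℕ : ℕ → Carrier
  fromℕ n = RawMonoidDefs._×_ +-rawMonoid n 1#

record Graph : Set₁ where
  field
    V          : Set
    Adj        : Rel V 0ℓ
    adj-sym    : Symmetric Adj
    adj-irrefl : Irreflexive _≡_ Adj

open Graph public using (V; Adj)

Walk : (G : Graph) → Rel (V G) 0ℓ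
Walk G = Star (Adj G)

vertices : ∀ G {u v} → Walk G u v → List (V G)
vertices G {u} ε       = u ∷ []
vertices G {u} (_ ◅ p) = u ∷ vertices G p

walkLength : ∀ G {u v} → Walk G u v → ℕ
walkLength G ε       = zero
walkLength G (_ ◅ p) = suc (walkLength G p)

IsPath : ∀ G {u v} → Walk G u v → Set
IsPath G p = Unique (vertices G p)

-- IsDist G u v n says that dist(u,v) is finite and equal to n; the distance
-- is ∞ exactly when no such n exists.
IsDist : (G : Graph) → V G → V G → ℕ → Set
IsDist G u v n =
  (Σ[ p ∈ Walk G u v ] (IsPath G p × walkLength G p ≡ n)) ×
  ((p : Walk G u v) → IsPath G p → n ℕ.≤ walkLength G p)

-- dist(u,v) ≤ x for a real x; in particular the distance is finite.
DistAtMost : (ℝ : RealField) (G : Graph) → V G → V G → RealField.Carrier ℝ → Set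
DistAtMost ℝ G u v x = ∃[ n ] (IsDist G u v n × fromℕ n ≤ x)
  where open RealField ℝ

-- Distances are measured in G, not in the subgraph induced on X.
DiameterAtMost : (ℝ : RealField) (G : Graph) → Pred (V G) 0ℓ → RealField.Carrier ℝ → Set
DiameterAtMost ℝ G X r = ∀ u v → u ∈ X → v ∈ X → DistAtMost ℝ G u v r

UnionOfBoundedSets : (ℝ : RealField) (G : Graph) → ℕ → RealField.Carrier ℝ →
                     Pred (V G) 0ℓ → Set₁
UnionOfBoundedSets ℝ G k r B =
  ∃[ n ] (n ℕ.≤ k × Σ[ X ∈ (Fin n → Pred (V G) 0ℓ) ]
    (B ≐ ⋃ (Fin n) X × (∀ i → DiameterAtMost ℝ G (X i) r)))

-- L and C are not required to be nonnegative here; this is imposed where the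
-- definition is used.
record IsQuasiIsometry (ℝ : RealField) (L C : RealField.Carrier ℝ) (G H : Graph)
                       (φ : V G → V H) : Set where
  open RealField ℝ
  field
    upper : ∀ u v d → IsDist G u v d →
            DistAtMost ℝ H (φ u) (φ v) (L * fromℕ d + C)
    lower : ∀ u v d → IsDist H (φ u) (φ v) d →
            DistAtMost ℝ G u v (L * fromℕ d + C)
    dense : ∀ y → ∃[ v ] DistAtMost ℝ H (φ v) y C

AdmitsQuasiIsometry : (ℝ : RealField) (L C : RealField.Carrier ℝ) (G H : Graph) → Set
AdmitsQuasiIsometry ℝ L C G H = ∃[ φ ] IsQuasiIsometry ℝ L C G H φ

record IsTree (T : Graph) : Set where
  field
    nonEmpty  : V T
    connected : ∀ u v → Σ[ p ∈ Walk T u v ] IsPath T p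
    -- A cycle is a path with at least two edges together with an edge joining
    -- its ends.
    acyclic   : ∀ {u v} (p : Walk T u v) → IsPath T p → 2 ℕ.≤ walkLength T p →
                ¬ Adj T v u

-- The bags containing a given vertex form a subtree.
Interpolates : (G T : Graph) → (V T → Pred (V G) 0ℓ) → Set
Interpolates G T bag =
  ∀ {t₁ t₂ t₃} (p : Walk T t₁ t₃) → IsPath T p → t₂ List.∈ vertices T p →
  ∀ {v} → v ∈ bag t₁ → v ∈ bag t₃ → v ∈ bag t₂

record TreeDecomposition (G : Graph) : Set₁ where
  field
    T            : Graph
    isTree       : IsTree T
    bag          : V T → Pred (V G) 0ℓ
    coversV      : ∀ v → ∃[ t ] v ∈ bag t
    coversE      : ∀ {u v} → Adj G u v → ∃[ t ] (u ∈ bag t × v ∈ bag t)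
    interpolates : Interpolates G T bag

record PseudoTreeDecomposition (G : Graph) : Set₁ where
  field
    T            : Graph
    isTree       : IsTree T
    bag          : V T → Pred (V G) 0ℓ
    coversV      : ∀ v → ∃[ t ] v ∈ bag t
    coversE      : ∀ {u v} → Adj G u v →
                   (∃[ t ] (u ∈ bag t × v ∈ bag t)) ⊎
                   (∃[ s ] ∃[ t ] (Adj T s t ×
                     (bag s ∖ bag t) ≐ ｛ u ｝ × (bag t ∖ bag s) ≐ ｛ v ｝))
    interpolates : Interpolates G T bag

HasCardinality : {A : Set} → Pred A 0ℓ → ℕ → Set
HasCardinality {A} X n =
  Σ[ xs ∈ List A ] (Unique xs × (∀ x → x List.∈ xs ⇔ x ∈ X) × length xs ≡ n)

-- The width is max |B_t|, without the usual −1.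
WidthAtMost : ∀ {G} → PseudoTreeDecomposition G → ℕ → Set
WidthAtMost D k = ∀ t → ∃[ n ] (HasCardinality (bag t) n × n ℕ.≤ k)
  where open PseudoTreeDecomposition D

-- The pseudo-tree-width is the minimum width over all
-- pseudo-tree-decompositions, so it is at most k when one of width at most k
-- exists.
PseudoTreeWidthAtMost : Graph → ℕ → Set₁
PseudoTreeWidthAtMost G k = Σ[ D ∈ PseudoTreeDecomposition G ] WidthAtMost D k

{-# OPTIONS --safe #-}
-- (b) In the bags of H, replace each vertex h by the set of all v for which φ(v) has distance at
-- most L + C from h.  Interpolation holds because balls are connected.
--
-- (a) Root the tree T.  Let the pieces be the bounded sets of which the bags are composed, and call
-- two pieces in conflict if they are close to each other.  At each node t, go greedily through the
-- pieces of the ancestors of t, the oldest first, and make a piece active if it is not in conflict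
-- with an active one and if it meets the bag at t, or was active at the parent of t and is still
-- close to the bag.  As active pieces are close to different pieces of the bag, there are at most k
-- of them.  Younger pieces have no influence on older ones.  Hence, if v has its highest bag at a,
-- the selection among the pieces of ancestors of a can change only when an active one gets far from
-- the bag, and a potential shows that this happens boundedly often on the way down from a.
--
-- The vertices of H are the maximal periods of activity of pieces.  Between the active sets of a
-- node and its parent, departing pieces are exchanged one by one for close arriving ones as long as
-- possible; these exchanges are the steps that a pseudo-tree-decomposition allows and that a
-- tree-decomposition of the same width would not.  So all active pieces close to v stay within
-- bounded distance in H, and mapping v to one of them is a quasi-isometry.
module Submission where

open import Defs
import Algebra.Properties.Monoid.Mult as MonoidMult
import Algebra.Properties.Ring as RingProperties
import Algebra.Properties.Semiring.Mult as SemiringMult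
open import Algebra.Bundles using (CommutativeRing)
open import Axiom.ExcludedMiddle using (ExcludedMiddle)
open import Axiom.Extensionality.Propositional using (Extensionality)
open import Data.Fin.Base as Fin using (Fin; zero; suc)
open import Data.Irrelevant using ([_])
open import Data.List.Base using (List; []; _∷_; _++_; length; lookup; filter; map; allFin)
import Data.List.Membership.Propositional as List
open import Data.List.Membership.Propositional.Properties
  using (∈-lookup; ∈-filter⁺; ∈-filter⁻; ∈-map⁺; ∈-map⁻; ∈-allFin; ∈-++⁺ˡ; ∈-++⁻)
open import Data.List.Properties
  using (++-assoc; filter-notAll; length-filter; length-map; length-tabulate)
open import Data.List.Relation.Unary.All as All using (All; []; _∷_)
open import Data.List.Relation.Unary.All.Properties using (¬Any⇒All¬)
open import Data.List.Relation.Unary.AllPairs using (AllPairs; []; _∷_)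
open import Data.List.Relation.Unary.Any using (here; there; index)
open import Data.List.Relation.Unary.Any.Properties using (lookup-index)
open import Data.List.Relation.Unary.Unique.Propositional using (Unique)
import Data.List.Relation.Unary.Unique.Propositional.Properties as Unique
open import Data.Nat.Base as ℕ using (ℕ; zero; suc; z≤n; s≤s)
import Data.Nat.Properties as ℕ
open import Data.Nat.Tactic.RingSolver using (solve-∀)
open import Data.Product.Base using (Σ-syntax; ∃-syntax; _×_; _,_; proj₁; proj₂)
open import Data.Refinement.Base using (Refinement; _,_; value)
open import Data.Sum.Base using (_⊎_; inj₁; inj₂; fromInj₂; [_,_]′; swap)
open import Function.Base using (_∘_; id)
open import Function.Bundles using (Equivalence; mk⇔)
open import Level using (0ℓ)
open import Relation.Binary.Construct.Closure.ReflexiveTransitive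
  using (ε; _◅_; _◅◅_; revApp; reverse)
open import Relation.Binary.Core using (Rel)
open import Relation.Binary.Definitions using (Symmetric; tri<; tri≈; tri>)
open import Relation.Binary.PropositionalEquality
  using (_≡_; _≢_; refl; sym; trans; cong; cong₂; subst; subst₂; module ≡-Reasoning)
open import Relation.Binary.Structures using (IsTotalOrder)
open import Relation.Nullary.Decidable.Core using (Dec; yes; no; ¬?; recompute; decidable-stable)
open import Relation.Nullary.Negation.Core using (¬_; contradiction)
open import Relation.Unary using (Pred; Decidable; _≐_; _∖_; ｛_｝)

-- Arithmetic in the real field and the Archimedean property.

module Reals (ℝ : RealField) where
  open RealField ℝ public hiding (_≈_; _+_; _*_; -_; 0#; 1#; Carrier)
  open CommutativeRing (RealField.commutativeRing ℝ) public
    using (Carrier; _≈_; _+_; _*_; -_; 0#; 1#; +-comm; +-assoc; *-comm; +-cong; *-cong;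
           +-identityˡ; +-identityʳ; -‿inverseˡ; -‿inverseʳ; distribˡ; distribʳ; *-identityˡ;
           *-identityʳ; *-assoc; semiring; ring; +-monoid)
    renaming (refl to ≈-refl; sym to ≈-sym; trans to ≈-trans)
  open IsTotalOrder isTotalOrder public using (total; antisym)
    renaming (refl to ≤-refl; reflexive to ≤-reflexive; trans to ≤-trans)

  +-monoˡ-≤ : ∀ x {y z} → y ≤ z → y + x ≤ z + x
  +-monoˡ-≤ x y≤z = ≤-trans (≤-reflexive (+-comm _ x))
    (≤-trans (+-monoʳ-≤ x y≤z) (≤-reflexive (+-comm x _)))

  +-mono-≤ : ∀ {w x y z} → w ≤ x → y ≤ z → w + y ≤ x + z
  +-mono-≤ w≤x y≤z = ≤-trans (+-monoˡ-≤ _ w≤x) (+-monoʳ-≤ _ y≤z)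

  +-nonNeg : ∀ {x y} → 0# ≤ x → 0# ≤ y → 0# ≤ x + y
  +-nonNeg 0≤x 0≤y = ≤-trans (≤-reflexive (≈-sym (+-identityˡ 0#))) (+-mono-≤ 0≤x 0≤y)

  ≤⇒0≤- : ∀ {x y} → x ≤ y → 0# ≤ y + - x
  ≤⇒0≤- {x} x≤y = ≤-trans (≤-reflexive (≈-sym (-‿inverseʳ x))) (+-monoˡ-≤ (- x) x≤y)

  +-cancel-neg : ∀ x y → (y + - x) + x ≈ y
  +-cancel-neg x y = ≈-trans (+-assoc y (- x) x)
    (≈-trans (+-cong ≈-refl (-‿inverseˡ x)) (+-identityʳ y))

  *-monoʳ-≤ : ∀ {x y z} → 0# ≤ x → y ≤ z → x * y ≤ x * z
  *-monoʳ-≤ {x} {y} {z} 0≤x y≤z =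
    ≤-trans (≤-reflexive (≈-sym (+-identityˡ (x * y))))
    (≤-trans (+-monoˡ-≤ (x * y) (*-nonNeg 0≤x (≤⇒0≤- y≤z)))
    (≤-reflexive (≈-trans (≈-sym (distribˡ x (z + - y) y))
                          (*-cong ≈-refl (+-cancel-neg y z)))))

  -- If 1 ≤ 0, then -1 is nonnegative and hence so is its square, which is 1.
  0≤1 : 0# ≤ 1#
  0≤1 = [ id , (λ 1≤0 → ≤-trans (square 1≤0) (≤-reflexive -1*-1≈1)) ]′ (total 0# 1#)
    where
    open RingProperties ring using (-‿distribˡ-*; -‿distribʳ-*; -‿involutive)
    -1*-1≈1 : (0# + - 1#) * (0# + - 1#) ≈ 1#
    -1*-1≈1 = ≈-trans (*-cong (+-identityˡ _) (+-identityˡ _))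
      (≈-trans (≈-sym (-‿distribˡ-* 1# (- 1#)))
      (≈-trans (CommutativeRing.-‿cong commutativeRing (*-identityˡ (- 1#))) (-‿involutive 1#)))
    square : 1# ≤ 0# → 0# ≤ (0# + - 1#) * (0# + - 1#)
    square 1≤0 = *-nonNeg (≤⇒0≤- 1≤0) (≤⇒0≤- 1≤0)

  fromℕ-nonNeg : ∀ n → 0# ≤ fromℕ n
  fromℕ-nonNeg zero    = ≤-refl
  fromℕ-nonNeg (suc n) = +-nonNeg 0≤1 (fromℕ-nonNeg n)

  fromℕ-mono : ∀ {m n} → m ℕ.≤ n → fromℕ m ≤ fromℕ n
  fromℕ-mono {n = n} ℕ.z≤n = fromℕ-nonNeg n
  fromℕ-mono (ℕ.s≤s m≤n) = +-monoʳ-≤ 1# (fromℕ-mono m≤n)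

  fromℕ-prefix : ∀ m n {x} → fromℕ (m ℕ.+ n) ≤ x → fromℕ m ≤ x
  fromℕ-prefix m n = ≤-trans (fromℕ-mono (ℕ.m≤m+n m n))

  fromℕ-+ : ∀ m n → fromℕ (m ℕ.+ n) ≈ fromℕ m + fromℕ n
  fromℕ-+ = MonoidMult.×-homo-+ +-monoid 1#

  fromℕ-* : ∀ m n → fromℕ (m ℕ.* n) ≈ fromℕ m * fromℕ n
  fromℕ-* = SemiringMult.×1-homo-* semiring

  fromℕ-affine : ∀ a b c → fromℕ (a ℕ.* b ℕ.+ c) ≈ fromℕ a * fromℕ b + fromℕ c
  fromℕ-affine a b c = ≈-trans (fromℕ-+ (a ℕ.* b) c) (+-cong (fromℕ-* a b) ≈-refl)

  fromℕ-2* : ∀ x → fromℕ 2 * x ≈ x + x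
  fromℕ-2* x = ≈-trans (distribʳ x 1# (1# + 0#)) (+-cong (*-identityˡ x)
    (≈-trans (*-cong (+-identityʳ 1#) ≈-refl) (*-identityˡ x)))

  +⇒-‿≤ : ∀ {x y z} → z + x ≤ y → x ≤ y + - z
  +⇒-‿≤ {x} {y} {z} z+x≤y = ≤-trans (≤-reflexive (≈-sym (≈-trans (+-cong (+-comm z x) ≈-refl)
    (≈-trans (+-assoc x z (- z)) (≈-trans (+-cong ≈-refl (-‿inverseʳ z)) (+-identityʳ x))))))
    (+-monoˡ-≤ (- z) z+x≤y)

  1≰0 : ¬ (1# ≤ 0#)
  1≰0 1≤0 = 0≉1 (antisym 0≤1 1≤0)

  -- If n < m, then n + 1 ≤ m ≤ n in the field, so 1 ≤ 0. This brings real bounds on distances back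
  -- to natural numbers.
  fromℕ-cancel-≤ : ∀ {m n} → fromℕ m ≤ fromℕ n → m ℕ.≤ n
  fromℕ-cancel-≤ {m} {n} m≤n = ℕ.≮⇒≥ λ n<m → 1≰0
    (≤-trans (+⇒-‿≤ (≤-trans (≤-reflexive (+-comm (fromℕ n) 1#)) (≤-trans (fromℕ-mono n<m) m≤n)))
             (≤-reflexive (-‿inverseʳ (fromℕ n))))

  archimedean : ExcludedMiddle 0ℓ → ∀ x → ∃[ n ] x ≤ fromℕ n
  archimedean em x with em {∃[ n ] x ≤ fromℕ n}
  ... | yes bound = bound
  ... | no ¬bound = contradiction 1≤0 1≰0
    where
    naturals : Carrier → Set
    naturals y = ∃[ n ] y ≡ fromℕ n
    x-upper : UpperBound naturals x
    x-upper _ (n , refl) = fromInj₂ (λ x≤n → contradiction (n , x≤n) ¬bound) (total x (fromℕ n))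
    sup = supremum naturals (0# , 0 , refl) (x , x-upper)
    s = proj₁ sup
    -- Since n + 1 ≤ s for every n, s − 1 is an upper bound as well.
    s-1-upper : UpperBound naturals (s + - 1#)
    s-1-upper _ (n , refl) = +⇒-‿≤ (proj₁ (proj₂ sup) _ (suc n , refl))
    s+1≤s : s + 1# ≤ s
    s+1≤s = ≤-trans (+-monoˡ-≤ 1# (proj₂ (proj₂ sup) _ s-1-upper)) (≤-reflexive (+-cancel-neg 1# s))
    1≤0 : 1# ≤ 0#
    1≤0 = ≤-trans (+⇒-‿≤ s+1≤s) (≤-reflexive (-‿inverseʳ s))

module _ where
  open import Data.Fin.Properties using (injective⇒≤; <-cmp)
  open import Data.List.Membership.Propositional using (_∈_; _∉_; lose)
  open import Data.List.Relation.Binary.Subset.Propositional using (_⊆_)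
  open import Data.Nat.Base using (pred; _+_; _*_; _∸_; _≤_; _<_)
  open import Data.Nat.Properties hiding (<-cmp)
  open import Data.List.Relation.Unary.Unique.Propositional.Properties using (Unique[x∷xs]⇒x∉xs)

  -- Walks and paths

  module _ (G : Graph) where

    start∈ : ∀ {u v} (p : Walk G u v) → u ∈ vertices G p
    start∈ ε       = here refl
    start∈ (_ ◅ _) = here refl

    end∈ : ∀ {u v} (p : Walk G u v) → v ∈ vertices G p
    end∈ ε       = here refl
    end∈ (_ ◅ p) = there (end∈ p)

    ∈-◅◅⁻ : ∀ {u v w x} (p : Walk G u v) (q : Walk G v w) →
            x ∈ vertices G (p ◅◅ q) → x ∈ vertices G p ⊎ x ∈ vertices G q
    ∈-◅◅⁻ ε       q x∈         = inj₂ x∈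
    ∈-◅◅⁻ (_ ◅ p) q (here eq)  = inj₁ (here eq)
    ∈-◅◅⁻ (_ ◅ p) q (there x∈) = [ inj₁ ∘ there , inj₂ ]′ (∈-◅◅⁻ p q x∈)

    reverseWalk : ∀ {u v} → Walk G u v → Walk G v u
    reverseWalk = reverse (Graph.adj-sym G)

    ∈-reverse⁻ : ∀ {u v x} (p : Walk G u v) → x ∈ vertices G (reverseWalk p) → x ∈ vertices G p
    ∈-reverse⁻ p x∈ = [ id , (λ where (here refl) → start∈ p) ]′ (go p ε x∈)
      where
      go : ∀ {u v w x} (p : Walk G u v) (q : Walk G u w) →
           x ∈ vertices G (revApp (Graph.adj-sym G) p q) → x ∈ vertices G p ⊎ x ∈ vertices G q
      go ε       q x∈ = inj₂ x∈
      go (e ◅ p) q x∈ with go p (Graph.adj-sym G e ◅ q) x∈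
      ... | inj₁ x∈p         = inj₁ (there x∈p)
      ... | inj₂ (here refl) = inj₁ (there (start∈ p))
      ... | inj₂ (there x∈q) = inj₂ x∈q

    length-◅◅ : ∀ {u v w} (p : Walk G u v) (q : Walk G v w) →
                walkLength G (p ◅◅ q) ≡ walkLength G p + walkLength G q
    length-◅◅ ε       q = refl
    length-◅◅ (_ ◅ p) q = cong suc (length-◅◅ p q)

    length-reverse : ∀ {u v} (p : Walk G u v) → walkLength G (reverseWalk p) ≡ walkLength G p
    length-reverse p = trans (go p ε) (+-identityʳ _)
      where
      go : ∀ {u v w} (p : Walk G u v) (q : Walk G u w) →
           walkLength G (revApp (Graph.adj-sym G) p q) ≡ walkLength G p + walkLength G q
      go ε       q = refl
      go (e ◅ p) q = trans (go p (Graph.adj-sym G e ◅ q)) (+-suc _ _)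

    length-vertices : ∀ {u v} (p : Walk G u v) → length (vertices G p) ≡ suc (walkLength G p)
    length-vertices ε       = refl
    length-vertices (_ ◅ p) = cong suc (length-vertices p)

    tail-isPath : ∀ {u v w} {e : Adj G u v} {p : Walk G v w} → IsPath G (e ◅ p) → IsPath G p
    tail-isPath (_ ∷ path) = path

    ◅-isPath : ∀ {u v w} {e : Adj G u v} {p : Walk G v w} →
               u ∉ vertices G p → IsPath G p → IsPath G (e ◅ p)
    ◅-isPath u∉p path = ¬Any⇒All¬ _ u∉p ∷ path

    suffix : ∀ {u v x} (p : Walk G u v) → IsPath G p → x ∈ vertices G p →
             Σ[ q ∈ Walk G x v ] (IsPath G q × (∀ {y} → y ∈ vertices G q → y ∈ vertices G p) ×
                                  walkLength G q ≤ walkLength G p)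
    suffix ε       path (here refl) = ε , path , id , ≤-refl
    suffix (e ◅ p) path (here refl) = e ◅ p , path , id , ≤-refl
    suffix (e ◅ p) path (there x∈)
      with q , q-path , q⊆p , len ← suffix p (tail-isPath {e = e} {p} path) x∈ =
      q , q-path , there ∘ q⊆p , m≤n⇒m≤1+n len

    -- Arbitrary walks compose without any appeal to minimality; `near⇒dist` and `dist⇒near`
    -- translate to and from distances.
    Near : ℕ → Rel (V G) 0ℓ
    Near m u v = Σ[ p ∈ Walk G u v ] walkLength G p ≤ m

    near-refl : ∀ {m u} → Near m u u
    near-refl = ε , z≤n

    near-sym : ∀ {m u v} → Near m u v → Near m v u
    near-sym (p , len) = reverseWalk p , ≤-trans (≤-reflexive (length-reverse p)) len

    near-trans : ∀ {m n u v w} → Near m u v → Near n v w → Near (m + n) u w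
    near-trans (p , p≤) (q , q≤) =
      p ◅◅ q , ≤-trans (≤-reflexive (length-◅◅ p q)) (+-mono-≤ p≤ q≤)

    near-mono : ∀ {m n u v} → m ≤ n → Near m u v → Near n u v
    near-mono m≤n (p , p≤) = p , ≤-trans p≤ m≤n

    near-edge : ∀ {u v} → Adj G u v → Near 1 u v
    near-edge e = e ◅ ε , ≤-refl

    -- Connectedness inside `P`. By `path-within`, this is all that interpolation in a tree asks
    -- for.
    Within : Pred (V G) 0ℓ → Rel (V G) 0ℓ
    Within P u v = Σ[ p ∈ Walk G u v ] (∀ {x} → x ∈ vertices G p → P x)

    within-refl : ∀ {P u} → P u → Within P u u
    within-refl pu = ε , λ where (here refl) → pu

    within-step : ∀ {P u v w} → Adj G u v → P u → Within P v w → Within P u w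
    within-step e pu (p , p⊆P) = e ◅ p , λ where
      (here refl) → pu
      (there x∈)  → p⊆P x∈

    within-trans : ∀ {P u v w} → Within P u v → Within P v w → Within P u w
    within-trans (p , p⊆P) (q , q⊆P) = p ◅◅ q , [ p⊆P , q⊆P ]′ ∘ ∈-◅◅⁻ p q

    within-sym : ∀ {P u v} → Within P u v → Within P v u
    within-sym (p , p⊆P) = reverseWalk p , p⊆P ∘ ∈-reverse⁻ p

  module Classical (em : ExcludedMiddle 0ℓ) where

    -- Loop erasure: if the first vertex reappears on the pruned tail, only the part from there on
    -- is kept.
    prune : ∀ (G : Graph) {u v} (p : Walk G u v) →
            Σ[ q ∈ Walk G u v ] (IsPath G q × (∀ {x} → x ∈ vertices G q → x ∈ vertices G p) ×
                                 walkLength G q ≤ walkLength G p)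
    prune G ε       = ε , [] ∷ [] , id , z≤n
    prune G {u} (e ◅ p) with prune G p
    ... | q , q-path , q⊆p , len with em {u ∈ vertices G q}
    ... | no u∉q  = e ◅ q , ◅-isPath G {e = e} {q} u∉q q-path
                  , (λ where (here eq) → here eq; (there x∈) → there (q⊆p x∈)) , s≤s len
    ... | yes u∈q with r , r-path , r⊆q , len′ ← suffix G q q-path u∈q =
      r , r-path , there ∘ q⊆p ∘ r⊆q , m≤n⇒m≤1+n (≤-trans len′ len)

    -- Trees

    module Tree {T : Graph} (isTree : IsTree T) where
      open IsTree isTree

      -- If x ≠ y, pruning `p` followed by the reverse of `q` gives a path from x to y that avoids
      -- a, and this closes to a cycle through a.
      firstStep-unique : ∀ {a x y b} → Adj T a x → Adj T a y →
                         (p : Walk T x b) (q : Walk T y b) →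
                         a ∉ vertices T p → a ∉ vertices T q → x ≡ y
      firstStep-unique {a} {x} {y} e f p q a∉p a∉q with em {x ≡ y}
      ... | yes eq = eq
      ... | no x≢y with prune T (p ◅◅ reverseWalk T q)
      ...   | ε     , _ = contradiction refl x≢y
      ...   | g ◅ r , r-path , r⊆ , _ =
        contradiction (Graph.adj-sym T f)
          (acyclic (e ◅ g ◅ r) (◅-isPath T {e = e} {g ◅ r} a∉r r-path) (s≤s (s≤s z≤n)))
        where
        a∉r : a ∉ vertices T (g ◅ r)
        a∉r a∈ = [ a∉p , a∉q ∘ ∈-reverse⁻ T q ]′ (∈-◅◅⁻ T p (reverseWalk T q) (r⊆ a∈))

      -- Only the vertex lists can be compared, as `Adj` may have several proofs for the same pair.
      path-unique : ∀ {a b} (p q : Walk T a b) → IsPath T p → IsPath T q →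
                    vertices T p ≡ vertices T q
      path-unique ε       ε       _  _  = refl
      path-unique ε       (_ ◅ q) _  qp = contradiction (end∈ T q) (Unique[x∷xs]⇒x∉xs qp)
      path-unique (_ ◅ p) ε       pp _  = contradiction (end∈ T p) (Unique[x∷xs]⇒x∉xs pp)
      path-unique (e ◅ p) (f ◅ q) pp qp
        with refl ← firstStep-unique e f p q (Unique[x∷xs]⇒x∉xs pp) (Unique[x∷xs]⇒x∉xs qp) =
        cong (_ ∷_) (path-unique p q (tail-isPath T {e = e} {p} pp) (tail-isPath T {e = f} {q} qp))

      path-length-unique : ∀ {a b} (p q : Walk T a b) → IsPath T p → IsPath T q →
                           walkLength T p ≡ walkLength T q
      path-length-unique p q pp qp = suc-injective (trans (sym (length-vertices T p))
        (trans (cong length (path-unique p q pp qp)) (length-vertices T q)))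

      -- Pruning a walk inside `P` yields a path with the same ends, and a tree has only one.
      path-within : ∀ {P a b x} (p : Walk T a b) → IsPath T p → Within T P a b → x ∈ vertices T p → P x
      path-within {x = x} p pp (w , w⊆P) x∈ with q , qp , q⊆w , _ ← prune T w =
        w⊆P (q⊆w (subst (x ∈_) (path-unique p q pp qp) x∈))

  -- Trees given by parent pointers

  record Rooting (N : Set) : Set where
    field
      root       : N
      par        : N → N
      depth      : N → ℕ
      depth-par  : ∀ t → depth (par t) ≡ pred (depth t)
      depth≡0    : ∀ {t} → depth t ≡ 0 → t ≡ root

    -- The depth equation excludes the root, which by `depth-par` and `depth≡0` is its own parent.
    Child : Rel N 0ℓ
    Child t s = depth t ≡ suc (depth s) × par t ≡ s

    Link : Rel N 0ℓ
    Link s t = Child s t ⊎ Child t s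

    child-par : ∀ {t n} → depth t ≡ suc n → Child t (par t)
    child-par {t} eq = trans eq (cong suc (sym (trans (depth-par t) (cong pred eq)))) , refl

    data _≼_ (a : N) : N → Set where
      ≼-refl : a ≼ a
      ≼-step : ∀ {t n} → depth t ≡ suc n → a ≼ par t → a ≼ t

    depth-≼ : ∀ {a t} → a ≼ t → depth a ≤ depth t
    depth-≼ ≼-refl = ≤-refl
    depth-≼ {t = t} (≼-step eq a≼) =
      ≤-trans (depth-≼ a≼) (≤-trans (≤-reflexive (depth-par t)) pred[n]≤n)

    root≼ : ∀ t → root ≼ t
    root≼ t = go (depth t) t refl
      where
      go : ∀ n t → depth t ≡ n → root ≼ t
      go zero    t eq rewrite depth≡0 eq = ≼-refl
      go (suc n) t eq = ≼-step eq (go n (par t) (trans (depth-par t) (cong pred eq)))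

    ≼-trans : ∀ {a b c} → a ≼ b → b ≼ c → a ≼ c
    ≼-trans p ≼-refl        = p
    ≼-trans p (≼-step eq q) = ≼-step eq (≼-trans p q)

    module _ {X : Set} (base : X) where

      atParent : (N → X) → N → X
      atParent f t with depth t
      ... | zero  = base
      ... | suc _ = f (par t)

      atParent-suc : ∀ {f t n} → depth t ≡ suc n → atParent f t ≡ f (par t)
      atParent-suc {t = t} eq with depth t
      atParent-suc refl | suc _ = refl

      module _ (step : N → X → X) where
        private
          go : ℕ → N → X
          go zero    t = step t base
          go (suc n) t = step t (go n (par t))

        -- Recursion down the tree, made structural by recursing on the depth.
        descend : N → X
        descend t = go (depth t) t

        descend-step : ∀ t → descend t ≡ step t (atParent descend t)
        descend-step t with depth t in eq
        ... | zero  = refl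
        ... | suc n = cong (λ m → step t (go m (par t))) (sym (trans (depth-par t) (cong pred eq)))

  module RootedTree {N : Set} (R : Rooting N) (em : ExcludedMiddle 0ℓ) where
    open Rooting R

    T : Graph
    T = record
      { V = N ; Adj = Link ; adj-sym = swap
      ; adj-irrefl = λ where refl (inj₁ (eq , _)) → 1+n≢n (sym eq)
                             refl (inj₂ (eq , _)) → 1+n≢n (sym eq) }

    ≼-walk : ∀ {a t} → a ≼ t → Walk T t a
    ≼-walk ≼-refl         = ε
    ≼-walk (≼-step eq a≼) = inj₁ (child-par eq) ◅ ≼-walk a≼

    -- After a step down to a child, a step up would return to the vertex just left. So the path
    -- goes on descending and arrives at its end from the parent of that end.
    par∈descending : ∀ {u x v} (c : Child x u) (q : Walk T x v) → IsPath T (inj₂ c ◅ q) →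
                     par v ∈ vertices T {u} (inj₂ c ◅ q) × depth x ≤ depth v
    par∈descending (_ , refl) ε _ = here refl , ≤-refl
    par∈descending (_ , refl) (inj₁ (_ , refl) ◅ q) path =
      contradiction (there (start∈ T q)) (Unique[x∷xs]⇒x∉xs path)
    par∈descending c (inj₂ d ◅ q) (_ ∷ path) with par∈descending d q path
    ... | par∈ , x≤v = there par∈ , ≤-trans (≤-trans (n≤1+n _) (≤-reflexive (sym (proj₁ d)))) x≤v

    -- By `par∈descending`, any step down would put the parent of the end on the path.
    depth-ascending : ∀ {x v} (p : Walk T x v) → IsPath T p → par v ∉ vertices T p →
                      depth v ≤ depth x
    depth-ascending ε _ _ = ≤-refl
    depth-ascending (inj₁ c ◅ p) (_ ∷ path) par∉ =
      ≤-trans (depth-ascending p path (par∉ ∘ there)) (≤-trans (n≤1+n _) (≤-reflexive (sym (proj₁ c))))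
    depth-ascending (inj₂ c ◅ p) path par∉ = contradiction (proj₁ (par∈descending c p path)) par∉

    -- If v is the parent of u, a path starting upwards meets v too early, and one starting
    -- downwards ends too deep. If v is a child of u, a path starting upwards can only ascend
    -- afterwards, as it must not return to u, and so ends too high; one starting downwards returns
    -- to u.
    acyclic : ∀ {u v} (p : Walk T u v) → IsPath T p → 2 ≤ walkLength T p → ¬ Link v u
    acyclic ε _ ()
    acyclic (_ ◅ ε) _ (s≤s ())
    acyclic (inj₁ (_ , u↦x) ◅ f ◅ p) (_ ∷ path) _ (inj₂ (_ , u↦v)) =
      contradiction (subst (_∈ vertices T p) (trans (sym u↦v) u↦x) (end∈ T p))
        (Unique[x∷xs]⇒x∉xs path)
    acyclic (inj₂ c ◅ f ◅ p) path _ (inj₂ (eq , _)) =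
      contradiction (≤-trans (≤-reflexive (sym (proj₁ c)))
                      (proj₂ (par∈descending c (f ◅ p) path)))
                    (<⇒≱ (≤-trans (≤-reflexive (sym eq)) (n≤1+n _)))
    acyclic (inj₁ c ◅ f ◅ p) path@(_ ∷ path′) _ (inj₁ (eq , refl)) =
      contradiction (depth-ascending (f ◅ p) path′ (Unique[x∷xs]⇒x∉xs path))
        (<⇒≱ (≤-trans (≤-reflexive (sym (proj₁ c))) (≤-trans (n≤1+n _) (≤-reflexive (sym eq)))))
    acyclic (inj₂ (_ , x↦u) ◅ inj₁ (_ , x↦y) ◅ p) path _ _ =
      contradiction (there (subst (_∈ vertices T p) (trans (sym x↦y) x↦u) (start∈ T p)))
        (Unique[x∷xs]⇒x∉xs path)
    acyclic (inj₂ _ ◅ inj₂ d ◅ p) path@(_ ∷ path′) _ (inj₁ (_ , refl)) =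
      contradiction (proj₁ (par∈descending d p path′)) (Unique[x∷xs]⇒x∉xs path)

    isTree : IsTree T
    isTree = record
      { nonEmpty  = root
      ; connected = λ u v →
          let p , path , _ = Classical.prune em T
                               (≼-walk (root≼ u) ◅◅ reverseWalk T (≼-walk (root≼ v)))
          in p , path
      ; acyclic   = acyclic
      }

  record Rooted (T : Graph) : Set where
    field
      rooting   : Rooting (V T)
    open Rooting rooting public
    field
      child⇒adj : ∀ {s t} → Child s t → Adj T s t
      adj⇒link  : ∀ {s t} → Adj T s t → Link s t

  -- Rooting an arbitrary tree.

  module _ (em : ExcludedMiddle 0ℓ) {T : Graph} (isTree : IsTree T) where
    open IsTree isTree
    open Classical em
    open Tree isTree

    private
      next : ∀ {u v} → Walk T u v → V T
      next {u} ε               = u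
      next (_◅_ {j = x} _ _) = x

      toRoot : ∀ t → Walk T t nonEmpty
      toRoot t = proj₁ (connected t nonEmpty)

      toRoot-path : ∀ t → IsPath T (toRoot t)
      toRoot-path t = proj₂ (connected t nonEmpty)

      depth-next : ∀ {t} (p : Walk T t nonEmpty) → IsPath T p →
                   walkLength T (toRoot (next p)) ≡ pred (walkLength T p)
      depth-next ε       path = path-length-unique (toRoot nonEmpty) ε (toRoot-path nonEmpty) path
      depth-next (e ◅ p) path =
        path-length-unique _ p (toRoot-path _) (tail-isPath T {e = e} {p} path)

      depth≡0′ : ∀ {t} (p : Walk T t nonEmpty) → walkLength T p ≡ 0 → t ≡ nonEmpty
      depth≡0′ ε _ = refl

      pathRooting : Rooting (V T)
      pathRooting = record
        { root       = nonEmpty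
        ; par        = λ t → next (toRoot t)
        ; depth      = λ t → walkLength T (toRoot t)
        ; depth-par  = λ t → depth-next (toRoot t) (toRoot-path t)
        ; depth≡0    = λ {t} → depth≡0′ (toRoot t)
        }

      open Rooting pathRooting

      child⇒adj : ∀ {s t} → Child s t → Adj T s t
      child⇒adj {s} = go (toRoot s)
        where
        go : ∀ {s t} (p : Walk T s nonEmpty) → walkLength T p ≡ suc (depth t) × next p ≡ t → Adj T s t
        go (e ◅ _) (_ , refl) = e

      child-from-path : ∀ {s t} (e : Adj T s t) (q : Walk T t nonEmpty) → IsPath T (e ◅ q) → Child s t
      child-from-path {s} {t} e q path =
        trans (path-length-unique (toRoot s) (e ◅ q) (toRoot-path s) path)
              (cong suc (path-length-unique q (toRoot t) (tail-isPath T {e = e} {q} path) (toRoot-path t)))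
        , next-unique (toRoot s) (toRoot-path s)
        where
        next-unique : (p : Walk T s nonEmpty) → IsPath T p → next p ≡ t
        next-unique ε       _  = contradiction (end∈ T q) (Unique[x∷xs]⇒x∉xs path)
        next-unique (f ◅ p) pp =
          firstStep-unique f e p q (Unique[x∷xs]⇒x∉xs pp) (Unique[x∷xs]⇒x∉xs path)

      -- If s is off the path from t to the root, prefixing s gives the path from s. Otherwise the
      -- part of that path from s on, prefixed by t, is the path from t.
      adj⇒link : ∀ {s t} → Adj T s t → Link s t
      adj⇒link {s} {t} e with em {s ∈ vertices T (toRoot t)}
      ... | no s∉  = inj₁ (child-from-path e (toRoot t) (◅-isPath T {e = e} {toRoot t} s∉ (toRoot-path t)))
      ... | yes s∈ = inj₂ (below (toRoot t) (toRoot-path t) s∈)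
        where
        below : (p : Walk T t nonEmpty) → IsPath T p → s ∈ vertices T p → Child t s
        below ε       _    (here refl) = contradiction e (Graph.adj-irrefl T refl)
        below (f ◅ p) _    (here refl) = contradiction e (Graph.adj-irrefl T refl)
        below (f ◅ p) path (there s∈p)
          with q , q-path , q⊆p , _ ← suffix T p (tail-isPath T {e = f} {p} path) s∈p =
          child-from-path (Graph.adj-sym T e) q
            (◅-isPath T {e = Graph.adj-sym T e} {q} (Unique[x∷xs]⇒x∉xs path ∘ q⊆p) q-path)

    rooted : Rooted T
    rooted = record { rooting = pathRooting ; child⇒adj = child⇒adj ; adj⇒link = adj⇒link }

  -- Counting in lists with pairwise related entries.

  allPairs-lookup : ∀ {A : Set} {R : Rel A 0ℓ} {xs} → AllPairs R xs →
                    ∀ {i j} → i Fin.< j → R (lookup xs i) (lookup xs j)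
  allPairs-lookup (r ∷ _)  {zero}  {suc j} _         = All.lookup r (∈-lookup j)
  allPairs-lookup (_ ∷ rs) {suc i} {suc j} (s≤s i<j) = allPairs-lookup rs i<j

  -- The pigeonhole principle. A general `R` serves both for distinct entries and for compatible
  -- pieces, and `f` may depend on the proof of membership.
  allPairs-length-≤ : ∀ {A : Set} {R : Rel A 0ℓ} {xs n} → AllPairs R xs →
                      (f : ∀ {x} → x ∈ xs → Fin n) →
                      (∀ {x y} (x∈ : x ∈ xs) (y∈ : y ∈ xs) → f x∈ ≡ f y∈ → ¬ R x y) →
                      length xs ≤ n
  allPairs-length-≤ {R = R} {xs} rs f same-value = injective⇒≤ {f = f ∘ ∈-lookup} injective
    where
    injective : ∀ {i j} → f (∈-lookup i) ≡ f (∈-lookup j) → i ≡ j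
    injective {i} {j} eq with <-cmp i j
    ... | tri< i<j _ _ = contradiction (allPairs-lookup rs i<j) (same-value _ _ eq)
    ... | tri≈ _ i≡j _ = i≡j
    ... | tri> _ _ j<i = contradiction (allPairs-lookup rs j<i) (same-value _ _ (sym eq))

  unique-⊆⇒length-≤ : ∀ {A : Set} {xs ys : List A} → Unique xs → xs ⊆ ys → length xs ≤ length ys
  unique-⊆⇒length-≤ {ys = ys} xs! xs⊆ys = allPairs-length-≤ xs! (index ∘ xs⊆ys)
    λ x∈ y∈ eq x≢y → x≢y (trans (lookup-index (xs⊆ys x∈))
                          (trans (cong (lookup ys) eq) (sym (lookup-index (xs⊆ys y∈)))))

  unique-⊂⇒length-< : ∀ {A : Set} {x : A} {xs ys} → Unique xs → xs ⊆ ys → x ∈ ys → x ∉ xs →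
                      length xs < length ys
  unique-⊂⇒length-< xs! xs⊆ys x∈ys x∉xs =
    unique-⊆⇒length-≤ (¬Any⇒All¬ _ x∉xs ∷ xs!) λ where
      (here refl) → x∈ys
      (there x∈)  → xs⊆ys x∈

  module _ {A : Set} {P : A → Set} where

    attach : ∀ xs → All P xs → List (Refinement A P)
    attach []       []       = []
    attach (x ∷ xs) (p ∷ ps) = (x , [ p ]) ∷ attach xs ps

    map-value-attach : ∀ xs ps → map value (attach xs ps) ≡ xs
    map-value-attach []       []       = refl
    map-value-attach (x ∷ xs) (_ ∷ ps) = cong (x ∷_) (map-value-attach xs ps)

    value-injective : {x y : Refinement A P} → value x ≡ value y → x ≡ y
    value-injective refl = refl

    attach-cardinality : ∀ {xs} → Unique xs → All P xs →
                         HasCardinality (λ x → value x ∈ xs) (length xs)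
    attach-cardinality {xs} xs! ps = attach xs ps
      , Unique.map⁻ (subst Unique (sym (map-value-attach xs ps)) xs!)
      , (λ x → mk⇔ (λ x∈ → subst (value x ∈_) (map-value-attach xs ps) (∈-map⁺ value x∈)) from)
      , trans (sym (length-map value (attach xs ps))) (cong length (map-value-attach xs ps))
      where
      from : ∀ {x} → value x ∈ xs → x ∈ attach xs ps
      from {x} x∈ with y , y∈ , eq ← ∈-map⁻ value (subst (value x ∈_) (sym (map-value-attach xs ps)) x∈) =
        subst (_∈ attach xs ps) (value-injective (sym eq)) y∈

  -- Passing from one bag to the next by exchanging single elements

  record Exchange {A : Set} (xs ys : List A) (d n : A) : Set where
    field
      d∈xs   : d ∈ xs
      d∉ys   : d ∉ ys
      n∈ys   : n ∈ ys
      n∉xs   : n ∉ xs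
      only-d : ∀ {x} → x ∈ xs → x ∉ ys → d ≡ x
      only-n : ∀ {x} → x ∈ ys → x ∉ xs → n ≡ x

  module Exchanges (em : ExcludedMiddle 0ℓ) {A : Set} (Close : Rel A 0ℓ) (target : List A) where

    Partner : List A → A → A → Set
    Partner xs n d = d ∈ xs × d ∉ target × Close d n

    differs? : (d : A) → Decidable (_≢ d)
    differs? d x = ¬? (em {x ≡ d})

    remove : A → List A → List A
    remove d = filter (differs? d)

    -- The decision is an argument, so that the lemmas below can split on it.
    replace : (xs : List A) (n : A) → Dec (∃[ d ] Partner xs n d) → List A
    replace xs n (yes (d , _)) = n ∷ remove d xs
    replace xs n (no _)        = xs

    step : List A → A → List A
    step xs n = replace xs n em

    -- The state after the first `i` newcomers have been processed; it is constant once they are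
    -- exhausted.
    run : List A → List A → ℕ → List A
    run ns       xs zero    = xs
    run []       xs (suc i) = xs
    run (n ∷ ns) xs (suc i) = run ns (step xs n) i

    replace-unique : ∀ {xs n} p? → Unique xs → n ∉ xs → Unique (replace xs n p?)
    replace-unique (yes (d , _)) xs! n∉ =
      ¬Any⇒All¬ _ (n∉ ∘ proj₁ ∘ ∈-filter⁻ (differs? d)) ∷ Unique.filter⁺ (differs? d) xs!
    replace-unique (no _) xs! _ = xs!

    replace-length : ∀ {xs n} p? → length (replace xs n p?) ≤ length xs
    replace-length {xs} (yes (d , d∈ , _)) = filter-notAll (differs? d) xs (lose d∈ λ d≢d → d≢d refl)
    replace-length (no _)                  = ≤-refl

    replace-⊆ : ∀ {xs n x} p? → x ∈ replace xs n p? → x ≡ n ⊎ x ∈ xs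
    replace-⊆ (yes _) (here eq)  = inj₁ eq
    replace-⊆ (yes (d , _)) (there x∈) = inj₂ (proj₁ (∈-filter⁻ (differs? d) x∈))
    replace-⊆ (no _)  x∈         = inj₂ x∈

    replace-keeps : ∀ {xs n x} p? → x ∈ target → x ∈ xs → x ∈ replace xs n p?
    replace-keeps (yes (d , _ , d∉ , _)) x∈t x∈ =
      there (∈-filter⁺ (differs? d) x∈ λ where refl → d∉ x∈t)
    replace-keeps (no _) _ x∈ = x∈

    replace-exchange : ∀ {xs n P} → n ∈ target → n ∉ xs → (p? : Dec (∃[ d ] Partner xs n d)) →
      Partner xs n P → ∃[ d ] (Partner xs n d × Exchange xs (replace xs n p?) d n)
    replace-exchange n∈t n∉ (no ¬p) p = contradiction (_ , p) ¬p
    replace-exchange {xs} {n} n∈t n∉ (yes (d , p@(d∈ , d∉t , _))) _ = d , p , record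
      { d∈xs   = d∈
      ; d∉ys   = λ where (here refl) → d∉t n∈t
                         (there d∈′) → proj₂ (∈-filter⁻ (differs? d) {xs = xs} d∈′) refl
      ; n∈ys   = here refl
      ; n∉xs   = n∉
      ; only-d = only-d
      ; only-n = λ where (here eq)  _  → sym eq
                         (there x∈) x∉ → contradiction (proj₁ (∈-filter⁻ (differs? d) x∈)) x∉
      }
      where
      only-d : ∀ {x} → x ∈ xs → x ∉ n ∷ filter (differs? d) xs → d ≡ x
      only-d x∈ x∉ = sym (decidable-stable em λ x≢d → x∉ (there (∈-filter⁺ (differs? d) x∈ x≢d)))

    replace-loses : ∀ {xs n P} → n ∈ target → n ∉ xs → (p? : Dec (∃[ d ] Partner xs n d)) →
      P ∈ xs → P ∉ replace xs n p? →
      Partner xs n P × Exchange xs (replace xs n p?) P n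
    replace-loses n∈t n∉ (no _) P∈ P∉ = contradiction P∈ P∉
    replace-loses n∈t n∉ p?@(yes (_ , p)) P∈ P∉
      with d , q , ex ← replace-exchange n∈t n∉ p? p
      with refl ← Exchange.only-d ex P∈ P∉ = q , ex

    module _ {n} {ns xs : List A} (ns! : Unique (n ∷ ns)) (disjoint : ∀ {x} → x ∈ n ∷ ns → x ∉ xs) where
      disjoint-step : ∀ {x} → x ∈ ns → x ∉ step xs n
      disjoint-step x∈ns x∈ with replace-⊆ em x∈
      ... | inj₁ refl = Unique.Unique[x∷xs]⇒x∉xs ns! x∈ns
      ... | inj₂ x∈xs = disjoint (there x∈ns) x∈xs

    run-unique : ∀ ns {xs} i → Unique ns → (∀ {x} → x ∈ ns → x ∉ xs) → Unique xs → Unique (run ns xs i)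
    run-unique ns       zero    _   _        xs! = xs!
    run-unique []       (suc i) _   _        xs! = xs!
    run-unique (n ∷ ns) (suc i) ns!@(_ ∷ ns!′) disjoint xs! =
      run-unique ns i ns!′ (disjoint-step ns! disjoint) (replace-unique em xs! (disjoint (here refl)))

    run-length : ∀ ns xs i → length (run ns xs i) ≤ length xs
    run-length ns       xs zero    = ≤-refl
    run-length []       xs (suc i) = ≤-refl
    run-length (n ∷ ns) xs (suc i) = ≤-trans (run-length ns (step xs n) i) (replace-length em)

    run-⊆ : ∀ ns {xs x} i → x ∈ run ns xs i → x ∈ ns ⊎ x ∈ xs
    run-⊆ ns       zero    x∈ = inj₂ x∈
    run-⊆ []       (suc i) x∈ = inj₂ x∈
    run-⊆ (n ∷ ns) (suc i) x∈ with run-⊆ ns i x∈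
    ... | inj₁ x∈ns = inj₁ (there x∈ns)
    ... | inj₂ x∈′  = [ inj₁ ∘ here , inj₂ ]′ (replace-⊆ em x∈′)

    run-keeps : ∀ ns {xs x} {i j} → i ≤ j → x ∈ target → x ∈ run ns xs i → x ∈ run ns xs j
    run-keeps ns       {j = zero}  z≤n _ x∈ = x∈
    run-keeps []       {j = suc j} z≤n _ x∈ = x∈
    run-keeps (n ∷ ns) {j = suc j} z≤n x∈t x∈ =
      run-keeps ns {i = 0} {j} z≤n x∈t (replace-keeps em x∈t x∈)
    run-keeps []       (s≤s _)   _   x∈ = x∈
    run-keeps (n ∷ ns) (s≤s i≤j) x∈t x∈ = run-keeps ns i≤j x∈t x∈

    -- Only newcomers are ever inserted, so any other element has been present from the outset.
    run-old : ∀ ns {xs x} {i j} → i ≤ j → x ∉ ns → x ∈ run ns xs j → x ∈ run ns xs i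
    run-old ns {j = j} z≤n x∉ x∈ = [ (λ x∈ns → contradiction x∈ns x∉) , id ]′ (run-⊆ ns j x∈)
    run-old []       (s≤s i≤j) x∉ x∈ = x∈
    run-old (n ∷ ns) (s≤s i≤j) x∉ x∈ = run-old ns i≤j (x∉ ∘ there) x∈

    -- The run need not exchange `P` for `n` themselves. It is enough that one exchange involves one
    -- of them; `near-exchange` reaches the other by one more edge.
    record ExchangeIn (ns xs : List A) (P n : A) : Set where
      field
        i        : ℕ
        i<length : i < length ns
        d n′     : A
        d∈xs     : d ∈ xs
        d∉target : d ∉ target
        n′∈ns    : n′ ∈ ns
        close    : Close d n′
        exchange : Exchange (run ns xs i) (run ns xs (suc i)) d n′
        involves : d ≡ P ⊎ n′ ≡ n

    -- When n is processed, either P has been exchanged before or n is exchanged now.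
    exchange-in : ∀ ns {xs P n} → Unique ns → (∀ {x} → x ∈ ns → x ∉ xs) → ns ⊆ target →
                  n ∈ ns → Partner xs n P → ExchangeIn ns xs P n
    exchange-in (n ∷ ns) ns! disjoint ns⊆ (here refl) p
      with d , (d∈ , d∉ , close) , ex ←
        replace-exchange (ns⊆ (here refl)) (disjoint (here refl)) em p =
      record { i = 0 ; i<length = s≤s z≤n ; d = d ; n′ = n ; d∈xs = d∈ ; d∉target = d∉
             ; n′∈ns = here refl ; close = close ; exchange = ex ; involves = inj₂ refl }
    exchange-in (m ∷ ns) {xs} {P} ns!@(_ ∷ ns!′) disjoint ns⊆ (there n∈) (P∈ , P∉t , close)
      with em {P ∈ step xs m}
    ... | no P∉ with (_ , _ , close′) , ex ←
                  replace-loses (ns⊆ (here refl)) (disjoint (here refl)) em P∈ P∉ =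
      record { i = 0 ; i<length = s≤s z≤n ; d = P ; n′ = m ; d∈xs = P∈ ; d∉target = P∉t
             ; n′∈ns = here refl ; close = close′ ; exchange = ex ; involves = inj₁ refl }
    ... | yes P∈′ = record
      { i = suc (E.i) ; i<length = s≤s E.i<length ; d = E.d ; n′ = E.n′
      -- What is removed later lies outside `target`, so it is not the `m` just inserted.
      ; d∈xs = [ (λ eq → contradiction (ns⊆ (here eq)) E.d∉target) , id ]′
                 (replace-⊆ em E.d∈xs)
      ; d∉target = E.d∉target ; n′∈ns = there E.n′∈ns ; close = E.close
      ; exchange = E.exchange ; involves = E.involves }
      where
      module E = ExchangeIn (exchange-in ns ns!′ (disjoint-step ns! disjoint) (ns⊆ ∘ there) n∈
                              (P∈′ , P∉t , close))

  -- Each node t becomes a ray (t , 0), (t , 1), …, where (t , 0) is attached to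
  -- (par t , K); infinite rays avoid a case distinction for the last index.
  module Subdivision {N : Set} (R : Rooting N) (K : ℕ) where
    open Rooting R

    par′ : N × ℕ → N × ℕ
    par′ (t , suc i) = t , i
    par′ (t , zero) with depth t
    ... | zero  = t , zero
    ... | suc _ = par t , K

    -- Going down past a node takes the K + 1 positions with indices 0 to K; the rest of the ray is
    -- a side branch.
    depth′ : N × ℕ → ℕ
    depth′ (t , i) = depth t * suc K + i

    par′-zero : ∀ {t n} → depth t ≡ suc n → par′ (t , 0) ≡ (par t , K)
    par′-zero {t} eq with depth t
    par′-zero refl | suc n = refl

    depth′-zero : ∀ {t n} → depth t ≡ suc n → depth′ (t , 0) ≡ suc (depth′ (par t , K))
    depth′-zero {t} {n} eq = begin
      depth t * suc K + 0           ≡⟨ +-identityʳ _ ⟩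
      depth t * suc K               ≡⟨ cong (_* suc K) eq ⟩
      suc (K + n * suc K)           ≡⟨ cong suc (+-comm K _) ⟩
      suc (n * suc K + K)           ≡⟨ cong (λ m → suc (m * suc K + K)) (cong pred eq) ⟨
      suc (pred (depth t) * suc K + K) ≡⟨ cong (λ m → suc (m * suc K + K)) (depth-par t) ⟨
      suc (depth (par t) * suc K + K) ∎
      where open ≡-Reasoning

    subdivided : Rooting (N × ℕ)
    subdivided = record
      { root       = root , 0
      ; par        = par′
      ; depth      = depth′
      ; depth-par  = depth′-par
      ; depth≡0    = depth′≡0
      }
      where
      depth′-par : ∀ x → depth′ (par′ x) ≡ pred (depth′ x)
      depth′-par (t , suc i) = cong pred (sym (+-suc (depth t * suc K) i))
      depth′-par (t , zero) with depth t in eq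
      ... | zero  = cong (λ d → d * suc K + 0) eq
      ... | suc n = trans (cong (λ d → d * suc K + K) (trans (depth-par t) (cong pred eq)))
                      (trans (+-comm (n * suc K) K) (sym (+-identityʳ _)))
      depth′≡0 : ∀ {x} → depth′ x ≡ 0 → x ≡ (root , 0)
      depth′≡0 {t , i} eq with depth t in eq′
      depth′≡0 {t , i} eq | zero = cong₂ _,_ (depth≡0 eq′) eq

    open Rooting subdivided using () renaming (Child to Child′; Link to Link′) public

    child-suc : ∀ t i → Child′ (t , suc i) (t , i)
    child-suc t i = +-suc (depth t * suc K) i , refl

    child-zero : ∀ {t n} → depth t ≡ suc n → Child′ (t , 0) (par t , K)
    child-zero eq = depth′-zero eq , par′-zero eq

  -- On the way from the bag at the parent of t to target t, the bag at t, new labels are exchanged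
  -- for close old ones as long as possible.
  module Assembly (em : ExcludedMiddle 0ℓ) {N : Set} (R : Rooting N) {Label : Set}
    (target : N → List Label) (target-unique : ∀ t → Unique (target t))
    (k : ℕ) (target-length : ∀ t → length (target t) ≤ k)
    (Close Match : Rel Label 0ℓ) (close-sym : Symmetric Close)
    (match⇒close : ∀ {x y} → Match x y → Close x y) where

    open Rooting R

    previous : N → List Label
    previous = atParent [] target

    ∈previous : ∀ {t x} → x ∈ previous t → ∃[ n ] (depth t ≡ suc n × x ∈ target (par t))
    ∈previous {t} x∈ with depth t
    ∈previous () | zero
    ∈previous x∈ | suc n = n , refl , x∈

    previous-unique : ∀ t → Unique (previous t)
    previous-unique t with depth t
    ... | zero  = []
    ... | suc _ = target-unique (par t)

    previous-length : ∀ t → length (previous t) ≤ k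
    previous-length t with depth t
    ... | zero  = z≤n
    ... | suc _ = target-length (par t)

    module WithBirth (birth : Label → N) (born : ∀ {t x} → x ∈ target t → x ∉ previous t → birth x ≡ t) where

      -- Indices 0 to k leave room for one step for each of the at most k newcomers; at `K` the bag
      -- becomes the target itself.
      K : ℕ
      K = suc k

      open Subdivision R K
      module E t = Exchanges em Match (target t)
      open RootedTree subdivided em using () renaming (T to T′; isTree to isTree′)

      newcomers : N → List Label
      newcomers t = filter (λ x → ¬? (em {x ∈ previous t})) (target t)

      newcomers-unique : ∀ t → Unique (newcomers t)
      newcomers-unique t = Unique.filter⁺ _ (target-unique t)

      newcomers-disjoint : ∀ {t x} → x ∈ newcomers t → x ∉ previous t
      newcomers-disjoint {t} = proj₂ ∘ ∈-filter⁻ _ {xs = target t}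

      newcomers⊆target : ∀ {t x} → x ∈ newcomers t → x ∈ target t
      newcomers⊆target = proj₁ ∘ ∈-filter⁻ _

      newcomers-length : ∀ t → length (newcomers t) ≤ k
      newcomers-length t = ≤-trans (length-filter _ (target t)) (target-length t)

      bagList : N × ℕ → List Label
      bagList (t , i) with i <? K
      ... | yes _ = E.run t (newcomers t) (previous t) i
      ... | no _  = target t

      bagList-low : ∀ {t i} → i < K → bagList (t , i) ≡ E.run t (newcomers t) (previous t) i
      bagList-low {i = i} i<K with i <? K
      ... | yes _  = refl
      ... | no i≮K = contradiction i<K i≮K

      bagList-high : ∀ {t i} → K ≤ i → bagList (t , i) ≡ target t
      bagList-high {i = i} K≤i with i <? K
      ... | yes i<K = contradiction K≤i (<⇒≱ i<K)
      ... | no _    = refl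

      Alive : Label → Set
      Alive x = ∃[ t ] x ∈ target t

      previous-alive : ∀ {t x} → x ∈ previous t → Alive x
      previous-alive x∈ = _ , proj₂ (proj₂ (∈previous x∈))

      bagList-alive : ∀ τ {x} → x ∈ bagList τ → Alive x
      bagList-alive (t , i) x∈ with i <? K
      ... | no _  = t , x∈
      ... | yes _ = [ (λ x∈new → t , newcomers⊆target x∈new) , previous-alive ]′
                      (E.run-⊆ t (newcomers t) i x∈)

      bagList-unique : ∀ τ → Unique (bagList τ)
      bagList-unique (t , i) with i <? K
      ... | no _  = target-unique t
      ... | yes _ = E.run-unique t (newcomers t) i (newcomers-unique t) newcomers-disjoint (previous-unique t)

      bagList-length : ∀ τ → length (bagList τ) ≤ k
      bagList-length (t , i) with i <? K
      ... | no _  = target-length t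
      ... | yes _ = ≤-trans (E.run-length t (newcomers t) (previous t) i) (previous-length t)

      -- Interpolation: the nodes whose bags contain x are all joined to the birth place of x.

      WithinBags : Label → N × ℕ → N × ℕ → Set
      WithinBags x = Within T′ (λ τ → x ∈ bagList τ)

      ray : ∀ {t x} i m → (∀ e → e ≤ m → x ∈ bagList (t , e + i)) → WithinBags x (t , m + i) (t , i)
      ray i zero    x∈ = within-refl T′ (x∈ 0 z≤n)
      ray i (suc m) x∈ = within-step T′ (inj₁ (child-suc _ _)) (x∈ (suc m) ≤-refl)
                           (ray i m (λ e e≤m → x∈ e (m≤n⇒m≤1+n e≤m)))

      high∈ : ∀ {t x i} → K ≤ i → x ∈ target t → x ∈ bagList (t , i)
      high∈ K≤i = subst (_ ∈_) (sym (bagList-high K≤i))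

      home : Label → N × ℕ
      home x = birth x , K

      to-parent : ∀ {t x i} → x ∈ previous t →
                  (∀ j → j ≤ i → x ∈ bagList (t , j)) → WithinBags x (t , i) (par t , K)
      to-parent {t} {x} {i} x∈p x∈below with n , eq , x∈s ← ∈previous x∈p =
        within-trans T′
          (subst (λ m → WithinBags x (t , m) (t , 0)) (+-identityʳ i)
            (ray 0 i λ e e≤i → subst (λ m → x ∈ bagList (t , m)) (sym (+-identityʳ e)) (x∈below e e≤i)))
          (within-step T′ (inj₁ (child-zero eq)) (x∈below 0 z≤n) (within-refl T′ (high∈ ≤-refl x∈s)))

      -- Induction on the depth. A label not born at `t` comes from the target of the parent and,
      -- belonging to `target t`, is never removed in between.
      target-to-home : ∀ n {t x} → depth t ≡ n → x ∈ target t → WithinBags x (t , K) (home x)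
      target-to-home n {t} {x} eq x∈t with em {x ∈ previous t}
      ... | no x∉p = subst (λ s → WithinBags x (t , K) (s , K)) (sym (born x∈t x∉p))
                       (within-refl T′ (high∈ ≤-refl x∈t))
      target-to-home n {t} {x} eq x∈t | yes x∈p with ∈previous x∈p
      target-to-home zero    eq x∈t | yes x∈p | n , eq′ , _ = contradiction (trans (sym eq) eq′) λ()
      target-to-home (suc n) {t} {x} eq x∈t | yes x∈p | _ , _ , x∈s =
        within-trans T′ (to-parent x∈p below)
          (target-to-home n (trans (depth-par t) (cong pred eq)) x∈s)
        where
        below : ∀ j → j ≤ K → x ∈ bagList (t , j)
        below j _ with j <? K
        ... | no _  = x∈t
        ... | yes _ = E.run-keeps t (newcomers t) {j = j} z≤n x∈t x∈p

      -- Beyond `K`, the ray leads back to index `K`. Below it, an old label is present at all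
      -- smaller indices and leads to the parent, while a new one persists up to index `K`.
      to-home : ∀ τ {x} → x ∈ bagList τ → WithinBags x τ (home x)
      to-home (t , i) {x} x∈ with i <? K | em {x ∈ previous t}
      ... | no i≮K | _ =
        within-trans T′
          (subst (λ m → WithinBags x (t , m) (t , K)) (m∸n+n≡m (≮⇒≥ i≮K))
            (ray K (i ∸ K) λ e _ → high∈ (m≤n+m K e) x∈))
          (target-to-home _ refl x∈)
      ... | yes i<K | yes x∈p =
        within-trans T′ (to-parent x∈p below)
          (target-to-home _ refl (proj₂ (proj₂ (∈previous x∈p))))
        where
        below : ∀ j → j ≤ i → x ∈ bagList (t , j)
        below j j≤i = subst (x ∈_) (sym (bagList-low (≤-<-trans j≤i i<K)))
          (E.run-old t (newcomers t) j≤i (λ x∈new → newcomers-disjoint x∈new x∈p) x∈)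
      ... | yes i<K | no x∉p =
        within-trans T′
          (within-sym T′ (subst (λ m → WithinBags x (t , m) (t , i)) (m∸n+n≡m (<⇒≤ i<K))
            (ray i (K ∸ i) λ e _ → above (e + i) (m≤n+m i e))))
          (target-to-home _ refl x∈t)
        where
        x∈t : x ∈ target t
        x∈t = [ newcomers⊆target , (λ x∈p → contradiction x∈p x∉p) ]′ (E.run-⊆ t (newcomers t) i x∈)
        above : ∀ j → i ≤ j → x ∈ bagList (t , j)
        above j i≤j with j <? K
        ... | no _  = x∈t
        ... | yes _ = E.run-keeps t (newcomers t) i≤j x∈t x∈

      -- The largest graph on the labels that joins only close labels and for which
      -- the bags form a pseudo-tree-decomposition.

      Vertex : Set
      Vertex = Refinement Label Alive

      bag : N × ℕ → Pred Vertex 0ℓ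
      bag τ x = value x ∈ bagList τ

      Covered : Rel Vertex 0ℓ
      Covered x y = (∃[ τ ] (bag τ x × bag τ y)) ⊎
        (∃[ σ ] ∃[ τ ] (Link′ σ τ × (bag σ ∖ bag τ) ≐ ｛ x ｝ × (bag τ ∖ bag σ) ≐ ｛ y ｝))

      covered-sym : Symmetric Covered
      covered-sym (inj₁ (τ , x∈ , y∈))         = inj₁ (τ , y∈ , x∈)
      covered-sym (inj₂ (σ , τ , e , ∖x , ∖y)) =
        inj₂ (τ , σ , Graph.adj-sym T′ e , ∖y , ∖x)

      H : Graph
      H = record
        { V = Vertex
        ; Adj = λ x y → x ≢ y × Close (value x) (value y) × Covered x y
        ; adj-sym = λ (x≢y , close , covered) → x≢y ∘ sym , close-sym close , covered-sym covered
        ; adj-irrefl = λ x≡y (x≢y , _) → x≢y x≡y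
        }

      vertex : ∀ {t x} → x ∈ target t → Vertex
      vertex {t} {x} x∈ = x , [ t , x∈ ]

      decomposition : PseudoTreeDecomposition H
      decomposition = record
        { T            = T′
        ; isTree       = isTree′
        ; bag          = bag
        -- A vertex carries its aliveness irrelevantly, so that equal labels give equal vertices;
        -- excluded middle recovers a usable proof.
        ; coversV      = λ (x , [ alive ]) → let t , x∈ = recompute em alive in (t , K) , high∈ ≤-refl x∈
        ; coversE      = λ (_ , _ , covered) → covered
        ; interpolates = λ {σ} {_} {τ} p path ρ∈ {x} x∈σ x∈τ →
            Classical.Tree.path-within em isTree′ p path
              (within-trans T′ (to-home σ x∈σ) (within-sym T′ (to-home τ x∈τ))) ρ∈
        }

      width : WidthAtMost decomposition k
      width τ = length (bagList τ)
              , attach-cardinality (bagList-unique τ) (All.tabulate (bagList-alive τ))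
              , bagList-length τ

      near-close : ∀ {x y} → Close (value x) (value y) → Covered x y → Near H 1 x y
      near-close {x} {y} close covered with em {x ≡ y}
      ... | yes refl = near-refl H
      ... | no x≢y   = near-edge H (x≢y , close , covered)

      near-target : ∀ {t} {x y : Vertex} → value x ∈ target t → value y ∈ target t →
                    Close (value x) (value y) → Near H 1 x y
      near-target {t} x∈ y∈ close = near-close close (inj₁ ((t , K) , high∈ ≤-refl x∈ , high∈ ≤-refl y∈))

      record Bridge (t : N) (p q : Label) : Set where
        field
          {d n}    : Label
          d∈       : d ∈ previous t
          n∈       : n ∈ target t
          match    : Match d n
          near     : ∀ {x y} → value x ≡ d → value y ≡ n → Near H 1 x y
          involves : d ≡ p ⊎ n ≡ q

      bridge : ∀ {t p q} → p ∈ previous t → p ∉ target t → q ∈ target t → q ∉ previous t →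
               Match p q → Bridge t p q
      bridge {t} {p} {q} p∈ p∉ q∈ q∉ match = record
        { d∈ = X.d∈xs ; n∈ = newcomers⊆target X.n′∈ns ; match = X.close ; near = near ; involves = X.involves }
        where
        module X = E.ExchangeIn t (E.exchange-in t (newcomers t) (newcomers-unique t) newcomers-disjoint
          newcomers⊆target (∈-filter⁺ _ q∈ q∉) (p∈ , p∉ , match))
        -- Thus both `X.i` and its successor are below `K`, where the bags follow the run.
        i<k : X.i < k
        i<k = <-≤-trans X.i<length (newcomers-length t)
        exchange : Exchange (bagList (t , X.i)) (bagList (t , suc X.i)) X.d X.n′
        exchange = subst₂ (λ xs ys → Exchange xs ys X.d X.n′)
          (sym (bagList-low (m<n⇒m<1+n i<k))) (sym (bagList-low (s≤s i<k))) X.exchange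
        module Y = Exchange exchange
        near : ∀ {x y} → value x ≡ X.d → value y ≡ X.n′ → Near H 1 x y
        near refl refl = near-close (match⇒close X.close) (inj₂ ((t , X.i) , (t , suc X.i) , inj₂ (child-suc t X.i)
          , ((λ (x∈ , x∉) → value-injective (Y.only-d x∈ x∉)) , λ where refl → Y.d∈xs , Y.d∉ys)
          , ((λ (x∈ , x∉) → value-injective (Y.only-n x∈ x∉)) , λ where refl → Y.n∈ys , Y.n∉xs)))

      module _ (match-sym : Symmetric Match) (match-match : ∀ {x y z} → Match x y → Match y z → Close x z) where

        -- If the exchange found removes x, then its newcomer and y both match x, so they are close
        -- and share the target at `t`. If it inserts y, the same argument applies to x and the
        -- removed label in the target of the parent.
        near-exchange : ∀ {t} (x y : Vertex) → value x ∈ previous t → value x ∉ target t →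
                        value y ∈ target t → value y ∉ previous t → Match (value x) (value y) →
                        Near H 2 x y
        near-exchange {t} x y x∈ x∉ y∈ y∉ match = cross (Bridge.involves b)
          where
          b = bridge x∈ x∉ y∈ y∉ match
          open Bridge b using (d; n; d∈; n∈) renaming (near to d-n; match to d~n)
          in-parent : ∀ {z} → z ∈ previous t → z ∈ target (par t)
          in-parent z∈ = proj₂ (proj₂ (∈previous z∈))
          d′ n′ : Vertex
          d′ = vertex (in-parent d∈)
          n′ = vertex n∈
          cross : d ≡ value x ⊎ n ≡ value y → Near H 2 x y
          cross (inj₁ d≡x) = near-trans H {m = 1} {v = n′} (d-n (sym d≡x) refl)
            (near-target n∈ y∈ (match-match (match-sym d~n) (subst (λ z → Match z (value y)) (sym d≡x) match)))
          cross (inj₂ n≡y) = near-trans H {m = 1} {v = d′}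
            (near-target (in-parent x∈) (in-parent d∈)
              (match-match match (match-sym (subst (Match d) n≡y d~n))))
            (d-n refl (sym n≡y))

  allPairs-∈ : ∀ {A : Set} {R : Rel A 0ℓ} {xs x y} → AllPairs R xs → x ∈ xs → y ∈ xs →
               x ≡ y ⊎ R x y ⊎ R y x
  allPairs-∈ _        (here refl) (here refl) = inj₁ refl
  allPairs-∈ (r ∷ _)  (here refl) (there y∈)  = inj₂ (inj₁ (All.lookup r y∈))
  allPairs-∈ (r ∷ _)  (there x∈)  (here refl) = inj₂ (inj₂ (All.lookup r x∈))
  allPairs-∈ (_ ∷ rs) (there x∈)  (there y∈)  = allPairs-∈ rs x∈ y∈

  -- The candidates are listed from the newest to the oldest, and older ones win.

  module Greedy (em : ExcludedMiddle 0ℓ) {A : Set} (Conflict : Rel A 0ℓ) where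

    Compatible : Rel A 0ℓ
    Compatible x y = ¬ Conflict x y

    addIf : ∀ {P : Set} → Dec P → A → List A → List A
    addIf (yes _) x xs = x ∷ xs
    addIf (no _)  x xs = xs

    greedy : Pred A 0ℓ → List A → List A
    greedy E []       = []
    greedy E (x ∷ xs) = addIf (em {E x × All (Compatible x) (greedy E xs)}) x (greedy E xs)

    module _ (E : Pred A 0ℓ) where

      greedy⊆ : ∀ xs → greedy E xs ⊆ xs
      greedy⊆ (x ∷ xs) y∈ with em {E x × All (Compatible x) (greedy E xs)}
      greedy⊆ (x ∷ xs) (here eq)  | yes _ = here eq
      greedy⊆ (x ∷ xs) (there y∈) | yes _ = there (greedy⊆ xs y∈)
      greedy⊆ (x ∷ xs) y∈         | no _  = there (greedy⊆ xs y∈)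

      greedy-eligible : ∀ xs {x} → x ∈ greedy E xs → E x
      greedy-eligible (x ∷ xs) y∈ with em {E x × All (Compatible x) (greedy E xs)}
      greedy-eligible (x ∷ xs) (here refl) | yes (ex , _) = ex
      greedy-eligible (x ∷ xs) (there y∈)  | yes _        = greedy-eligible xs y∈
      greedy-eligible (x ∷ xs) y∈          | no _         = greedy-eligible xs y∈

      greedy-compatible : ∀ xs → AllPairs Compatible (greedy E xs)
      greedy-compatible []       = []
      greedy-compatible (x ∷ xs) with em {E x × All (Compatible x) (greedy E xs)}
      ... | yes (_ , compat) = compat ∷ greedy-compatible xs
      ... | no _             = greedy-compatible xs

      -- The front of the list is decided last, without influence on the choices behind it.
      greedy-++ : ∀ xs {ys} → greedy E ys ⊆ greedy E (xs ++ ys)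
      greedy-++ []            y∈ = y∈
      greedy-++ (x ∷ xs) {ys} y∈ with em {E x × All (Compatible x) (greedy E (xs ++ ys))}
      ... | yes _ = there (greedy-++ xs y∈)
      ... | no _  = greedy-++ xs y∈

      module _ (reflexive : ∀ {x} → E x → Conflict x x) where

        -- An eligible element is rejected only because of a conflict with a chosen one; a chosen
        -- element is in conflict with itself.
        greedy-maximal : ∀ xs {x} → x ∈ xs → E x → ∃[ y ] (y ∈ greedy E xs × Conflict x y)
        greedy-maximal (x ∷ xs) x∈ ex with em {E x × All (Compatible x) (greedy E xs)}
        greedy-maximal (x ∷ xs) (here refl) ex | yes _ = x , here refl , reflexive ex
        greedy-maximal (x ∷ xs) (there x∈)  ex | yes _
          with y , y∈ , conflict ← greedy-maximal xs x∈ ex = y , there y∈ , conflict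
        greedy-maximal (x ∷ xs) (there x∈)  ex | no _  = greedy-maximal xs x∈ ex
        greedy-maximal (x ∷ xs) (here refl) ex | no ¬c =
          decidable-stable em λ none →
            ¬c (ex , All.tabulate λ y∈ conflict → none (_ , y∈ , conflict))

        greedy-unique : ∀ xs → Unique (greedy E xs)
        greedy-unique []       = []
        greedy-unique (x ∷ xs) with em {E x × All (Compatible x) (greedy E xs)}
        ... | yes (ex , compat) =
          ¬Any⇒All¬ _ (λ x∈ → All.lookup compat x∈ (reflexive ex)) ∷ greedy-unique xs
        ... | no _              = greedy-unique xs

    -- By induction the earlier choices agree. What was chosen stays eligible and nothing becomes
    -- eligible, so the next decision agrees as well.
    greedy-cong : ∀ {E F : Pred A 0ℓ} xs → (∀ {x} → x ∈ greedy E xs → F x) →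
                  (∀ {x} → x ∈ xs → F x → E x) → greedy F xs ≡ greedy E xs
    greedy-cong []       _     _   = refl
    greedy-cong {E} {F} (x ∷ xs) keeps F⊆E
      with em {E x × All (Compatible x) (greedy E xs)} | em {F x × All (Compatible x) (greedy F xs)}
    ... | yes _        | yes _ = cong (x ∷_) (greedy-cong xs (keeps ∘ there) (F⊆E ∘ there))
    ... | no _         | no _  = greedy-cong xs keeps (F⊆E ∘ there)
    ... | yes (_ , c)  | no ¬F = contradiction
      (keeps (here refl) , subst (All (Compatible x)) (sym (greedy-cong xs (keeps ∘ there) (F⊆E ∘ there))) c) ¬F
    ... | no ¬E        | yes (fx , c) = contradiction
      (F⊆E (here refl) fx , subst (All (Compatible x)) (greedy-cong xs keeps (F⊆E ∘ there)) c) ¬E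

  -- Ancestor chains in a tree-decomposition.

  module ChainsInDecomposition (em : ExcludedMiddle 0ℓ) {G : Graph} (D : TreeDecomposition G)
    (R : Rooted (TreeDecomposition.T D)) where
    open TreeDecomposition D
    open Rooted R

    -- The depth bound ensures that prefixing a child of `t` gives a path again.
    ChainPath : V T → V T → V T → Set
    ChainPath a s t = Σ[ p ∈ Walk T t a ] (IsPath T p × s ∈ vertices T p ×
                                           (∀ {x} → x ∈ vertices T p → depth x ≤ depth t))

    chain-extend : ∀ {a s s′ t n} → depth t ≡ suc n → ChainPath a s (par t) →
                   (∀ {p : Walk T (par t) a} {e : Adj T t (par t)} →
                      s ∈ vertices T p → s′ ∈ vertices T (e ◅ p)) →
                   ChainPath a s′ t
    chain-extend {t = t} eq (p , path , s∈ , ≤par) s′∈ =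
      e ◅ p , ◅-isPath T {e = e} {p} (λ t∈ → <⇒≱ par<t (≤par t∈)) path , s′∈ {p} {e} s∈ , λ where
        (here refl) → ≤-refl
        (there x∈)  → ≤-trans (≤par x∈) (<⇒≤ par<t)
      where
      e = child⇒adj (child-par eq)
      par<t : depth (par t) < depth t
      par<t = ≤-reflexive (sym (proj₁ (child-par eq)))

    chain-path : ∀ {a s t} → a ≼ s → s ≼ t → ChainPath a s t
    chain-path ≼-refl ≼-refl = ε , [] ∷ [] , here refl , λ where (here refl) → ≤-refl
    chain-path {t = t} (≼-step eq a≼) ≼-refl =
      chain-extend {s = par t} eq (chain-path a≼ ≼-refl) (λ _ → here refl)
    chain-path a≼ (≼-step eq s≼) = chain-extend eq (chain-path a≼ s≼) there

    bag-convex : ∀ {a s t v} → a ≼ s → s ≼ t → bag a v → bag t v → bag s v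
    bag-convex a≼s s≼t v∈a v∈t with p , path , s∈p , _ ← chain-path a≼s s≼t =
      interpolates p path s∈p v∈t v∈a

    -- A node of least depth works. The path to it from any bag containing v stays in such bags, and
    -- followed backwards it never leaves the descendants of that node, as this would lead to
    -- smaller depth.
    highest : ∀ v → ∃[ a ] (bag a v × (∀ {t} → bag t v → a ≼ t))
    highest v = let a , v∈a , minimal = go _ (proj₁ (coversV v)) ≤-refl (proj₂ (coversV v))
                in a , v∈a , λ {t} v∈t →
                     let p , path = IsTree.connected isTree t a
                     in above minimal p λ x∈ → interpolates p path x∈ v∈t v∈a
      where
      go : ∀ n t → depth t ≤ n → bag t v → ∃[ a ] (bag a v × (∀ {t} → bag t v → depth a ≤ depth t))
      go n t t≤n v∈t with em {∃[ s ] (bag s v × depth s < depth t)}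
      go n       t t≤n v∈t | no none = t , v∈t , λ v∈s → ≮⇒≥ λ s<t → none (_ , v∈s , s<t)
      go zero    t t≤n v∈t | yes (s , v∈s , s<t) = contradiction (≤-trans s<t t≤n) λ()
      go (suc n) t t≤n v∈t | yes (s , v∈s , s<t) = go n s (≤-pred (≤-trans s<t t≤n)) v∈s

      above : ∀ {a t} → (∀ {s} → bag s v → depth a ≤ depth s) → (p : Walk T t a) →
              (∀ {x} → x ∈ vertices T p → bag x v) → a ≼ t
      above minimal ε _ = ≼-refl
      above minimal (e ◅ p) ⊆v with adj⇒link e | above minimal p (⊆v ∘ there)
      ... | inj₁ (eq , refl) | a≼ = ≼-step eq a≼
      ... | inj₂ (eq , refl) | ≼-refl =
        contradiction (≤-trans (≤-reflexive (sym eq)) (minimal (⊆v (here refl)))) 1+n≰n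
      ... | inj₂ (eq , refl) | ≼-step _ a≼ = a≼

  -- The constants of part (a), for pieces of diameter at most r.

  module Constants (k r : ℕ) where

    -- A conflict spans 3r, and the piece containing the vertex adds r; see `cover`.
    near-radius : ℕ
    near-radius = r + r + r + r

    -- Allows for pieces near the two ends of an edge.
    match-distance : ℕ
    match-distance = suc (near-radius + near-radius)

    -- Two matches through a common piece, which has to be crossed.
    close-distance : ℕ
    close-distance = match-distance + r + match-distance

    -- Two edges for each drop of a potential that is at most `suc k * k + k`, one edge at the
    -- highest bag, and one at the bag considered.
    spread : ℕ
    spread = 2 + (suc k * k + k) * 2

    edge-length : ℕ
    edge-length = spread + 1 + spread

  -- Active pieces and the graph built from them.

  module Contraction (em : ExcludedMiddle 0ℓ) {G : Graph} (D : TreeDecomposition G)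
    (R : Rooted (TreeDecomposition.T D)) (k r : ℕ)
    (pieces : V (TreeDecomposition.T D) → ℕ) (pieces≤k : ∀ t → pieces t ≤ k)
    (piece : ∀ t → Fin (pieces t) → Pred (V G) 0ℓ)
    (bag⇒piece : ∀ {t v} → TreeDecomposition.bag D t v → ∃[ i ] piece t i v)
    (piece⇒bag : ∀ {t i v} → piece t i v → TreeDecomposition.bag D t v)
    (piece-near : ∀ {t i u v} → piece t i u → piece t i v → Near G r u v) where

    open TreeDecomposition D
    open Rooted R
    open ChainsInDecomposition em D R
    open Constants k r

    Piece : Set
    Piece = Σ[ t ∈ V T ] Fin (pieces t)

    member : Piece → Pred (V G) 0ℓ
    member (t , i) = piece t i

    Distance≤ : ℕ → Rel Piece 0ℓ
    Distance≤ d P Q = ∃[ p ] ∃[ q ] (member P p × member Q q × Near G d p q)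

    distance-sym : ∀ {d} → Symmetric (Distance≤ d)
    distance-sym (p , q , p∈ , q∈ , near) = q , p , q∈ , p∈ , near-sym G near

    distance-mono : ∀ {d e P Q} → d ≤ e → Distance≤ d P Q → Distance≤ e P Q
    distance-mono d≤e (p , q , p∈ , q∈ , near) = p , q , p∈ , q∈ , near-mono G d≤e near

    -- The bound 3r is what two pieces within r of the same piece of a bag satisfy.
    Conflict : Rel Piece 0ℓ
    Conflict = Distance≤ (r + r + r)

    open Greedy em Conflict

    Touches : V T → Pred Piece 0ℓ
    Touches t P = ∃[ p ] (member P p × bag t p)

    Hovers : V T → Pred Piece 0ℓ
    Hovers t P = ∃[ p ] ∃[ q ] (member P p × bag t q × Near G r p q)

    -- Due to the hysteresis, an active piece is dropped only when all pieces of older bags that it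
    -- meets have left the bag; see supported⇒hovers.
    Eligible : V T → List Piece → Pred Piece 0ℓ
    Eligible t Ps P = Touches t P ⊎ (P ∈ Ps × Hovers t P)

    touches⇒hovers : ∀ {t P} → Touches t P → Hovers t P
    touches⇒hovers (p , p∈P , p∈t) = p , p , p∈P , p∈t , near-refl G

    eligible⇒hovers : ∀ {t Ps P} → Eligible t Ps P → Hovers t P
    eligible⇒hovers = [ touches⇒hovers , proj₂ ]′

    eligible⇒conflict : ∀ {t Ps P} → Eligible t Ps P → Conflict P P
    eligible⇒conflict e with p , _ , p∈ , _ ← eligible⇒hovers e = p , p , p∈ , p∈ , near-refl G

    candidates : V T → List Piece
    candidates = descend [] λ t Ps → map (t ,_) (allFin (pieces t)) ++ Ps

    active : V T → List Piece
    active = descend [] λ t Ps → greedy (Eligible t Ps) (candidates t)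

    inherited : V T → List Piece
    inherited = atParent [] active

    -- The selection at `t` among the pieces from ancestors of `a` only; for `a ≼ t` it is the
    -- oldest part of `active t`.
    chosen : V T → V T → List Piece
    chosen a t = greedy (Eligible t (inherited t)) (candidates a)

    active≡chosen : ∀ t → active t ≡ chosen t t
    active≡chosen = descend-step [] _

    inherited-suc : ∀ {t n} → depth t ≡ suc n → inherited t ≡ active (par t)
    inherited-suc = atParent-suc []

    ∈inherited : ∀ {t P} → P ∈ inherited t → ∃[ n ] (depth t ≡ suc n × P ∈ active (par t))
    ∈inherited {t} P∈ with depth t
    ∈inherited () | zero
    ∈inherited P∈ | suc n = n , refl , P∈

    active-eligible : ∀ {t P} → P ∈ active t → Eligible t (inherited t) P
    active-eligible {t} {P} P∈ = greedy-eligible _ (candidates t) (subst (P ∈_) (active≡chosen t) P∈)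

    active-unique : ∀ t → Unique (active t)
    active-unique t = subst Unique (sym (active≡chosen t)) (greedy-unique _ eligible⇒conflict (candidates t))

    active-compatible : ∀ t → AllPairs Compatible (active t)
    active-compatible t = subst (AllPairs Compatible) (sym (active≡chosen t)) (greedy-compatible _ (candidates t))

    -- Compatible active pieces hover about different pieces of the bag.
    active-length : ∀ t → length (active t) ≤ k
    active-length t = ≤-trans (allPairs-length-≤ (active-compatible t)
        (λ P∈ → proj₁ (bag⇒piece (proj₁ (proj₂ (proj₂ (proj₂ (hovering P∈))))))) conflict)
      (pieces≤k t)
      where
      hovering : ∀ {P} → P ∈ active t → Hovers t P
      hovering P∈ = eligible⇒hovers (active-eligible P∈)
      conflict : ∀ {P Q} (P∈ : P ∈ active t) (Q∈ : Q ∈ active t) → _ → ¬ ¬ Conflict P Q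
      conflict P∈ Q∈ eq ¬conflict
        with p , p′ , p∈ , p′∈ , p-p′ ← hovering P∈
           | q , q′ , q∈ , q′∈ , q-q′ ← hovering Q∈
        with i , p′∈i ← bag⇒piece p′∈
           | j , q′∈j ← bag⇒piece q′∈
        with refl ← eq =
        ¬conflict (p , q , p∈ , q∈ ,
          near-trans G (near-trans G p-p′ (piece-near p′∈i q′∈j)) (near-sym G q-q′))

    candidates-step : ∀ {t n} → depth t ≡ suc n →
                      candidates t ≡ map (t ,_) (allFin (pieces t)) ++ candidates (par t)
    candidates-step {t} eq = trans (descend-step [] _ t)
      (cong (map (t ,_) (allFin (pieces t)) ++_) (atParent-suc [] eq))

    candidates-own : ∀ t i → (t , i) ∈ candidates t
    candidates-own t i = subst ((t , i) ∈_) (sym (descend-step [] _ t))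
      (∈-++⁺ˡ (∈-map⁺ (t ,_) (∈-allFin i)))

    candidates-≼ : ∀ {t P} → P ∈ candidates t → proj₁ P ≼ t
    candidates-≼ {t} = go _ t refl
      where
      go : ∀ n t {P} → depth t ≡ n → P ∈ candidates t → proj₁ P ≼ t
      go n t {P} eq P∈ with ∈-++⁻ (map (t ,_) (allFin (pieces t))) (subst (P ∈_) (descend-step [] _ t) P∈)
      ... | inj₁ P∈t with _ , _ , refl ← ∈-map⁻ (t ,_) P∈t = ≼-refl
      go zero    t {P} eq P∈ | inj₂ P∈s with depth t
      go zero    t {P} eq P∈ | inj₂ () | zero
      go (suc n) t {P} eq P∈ | inj₂ P∈s =
        ≼-step eq (go n (par t) (trans (depth-par t) (cong pred eq)) (subst (P ∈_) (atParent-suc [] eq) P∈s))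

    candidates-suffix : ∀ {a t} → a ≼ t → ∃[ Ps ] candidates t ≡ Ps ++ candidates a
    candidates-suffix ≼-refl = [] , refl
    candidates-suffix {t = t} (≼-step eq a≼) with Ps , eq′ ← candidates-suffix a≼ =
      map (t ,_) (allFin (pieces t)) ++ Ps ,
      trans (candidates-step eq) (trans (cong (map (t ,_) (allFin (pieces t)) ++_) eq′)
        (sym (++-assoc (map (t ,_) (allFin (pieces t))) Ps _)))
      where open import Data.List.Properties using (++-assoc)

    chosen⊆active : ∀ {a t} → a ≼ t → chosen a t ⊆ active t
    chosen⊆active {a} {t} a≼t {P} P∈ with Ps , eq ← candidates-suffix a≼t =
      subst (P ∈_) (sym (trans (active≡chosen t) (cong (greedy _) eq))) (greedy-++ _ Ps P∈)

    chosen-unique : ∀ a t → Unique (chosen a t)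
    chosen-unique a t = greedy-unique _ eligible⇒conflict (candidates a)

    chosen-maximal : ∀ {a t P} → P ∈ candidates a → Eligible t (inherited t) P →
                     ∃[ Q ] (Q ∈ chosen a t × Conflict P Q)
    chosen-maximal {a} = greedy-maximal _ eligible⇒conflict (candidates a)

    -- By maximality P is in conflict with a chosen piece. Both are active, hence they coincide.
    active∩candidates⊆chosen : ∀ {a t P} → a ≼ t → P ∈ active t → P ∈ candidates a → P ∈ chosen a t
    active∩candidates⊆chosen {a} {t} a≼t P∈ P∈a
      with Q , Q∈ , conflict ← chosen-maximal P∈a (active-eligible P∈)
      with allPairs-∈ (active-compatible t) P∈ (chosen⊆active a≼t Q∈)
    ... | inj₁ refl           = Q∈
    ... | inj₂ (inj₁ compat) = contradiction conflict compat
    ... | inj₂ (inj₂ compat) = contradiction (distance-sym conflict) compat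

    NearPiece : Piece → Pred (V G) 0ℓ
    NearPiece P v = ∃[ p ] (member P p × Near G (r + r + r + r) p v)

    -- The piece of v at `a` touches the bag at `t` in v itself, so it is eligible and in conflict
    -- with a chosen piece.
    cover : ∀ {a t v} → bag a v → bag t v → ∃[ P ] (P ∈ chosen a t × NearPiece P v)
    cover {a} {t} {v} v∈a v∈t with i , v∈i ← bag⇒piece v∈a
      with P , P∈ , conflict ← chosen-maximal (candidates-own a i) (inj₁ (v , v∈i , v∈t))
      with q , p , q∈ , p∈ , near ← conflict =
      P , P∈ , p , p∈ , near-trans G (near-sym G near) (piece-near q∈ v∈i)

    cover-active : ∀ {t v} → bag t v → ∃[ P ] (P ∈ active t × NearPiece P v)
    cover-active {t} v∈t with P , P∈ , near ← cover v∈t v∈t = P , chosen⊆active ≼-refl P∈ , near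

    -- The potential drops whenever the choice among the candidates of a changes: as long as no piece
    -- of a leaves the bag, newly chosen candidates are supported and hence are not dropped.

    module Potential (a : V T) where

      Alive : V T → Pred (Fin (pieces a)) 0ℓ
      Alive t i = ∃[ q ] (piece a i q × bag t q)

      Supported : V T → Pred Piece 0ℓ
      Supported t P = ∃[ i ] (Alive t i × ∃[ p ] (member P p × piece a i p))

      alive? : ∀ t → Decidable (Alive t)
      alive? t i = em

      unsupported? : ∀ t → Decidable (λ P → ¬ Supported t P)
      unsupported? t P = em

      alive : V T → List (Fin (pieces a))
      alive t = filter (alive? t) (allFin (pieces a))

      unsupported : V T → List Piece
      unsupported t = filter (unsupported? t) (chosen a t)

      -- At most k chosen pieces are unsupported, so with weight k + 1 the loss of one piece of `a`
      -- outweighs any increase in their number.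
      potential : V T → ℕ
      potential t = suc k * length (alive t) + length (unsupported t)

      -- A piece of `a` that meets both P and the bag has diameter at most r, which explains the
      -- radius in `Hovers`.
      supported⇒hovers : ∀ {t P} → Supported t P → Hovers t P
      supported⇒hovers (i , (q , q∈i , q∈t) , p , p∈P , p∈i) = p , q , p∈P , q∈t , piece-near p∈i q∈i

      unsupported-unique : ∀ t → Unique (unsupported t)
      unsupported-unique t = Unique.filter⁺ (unsupported? t) (chosen-unique a t)

      alive-unique : ∀ t → Unique (alive t)
      alive-unique t = Unique.filter⁺ (alive? t) (Unique.allFin⁺ (pieces a))

      unsupported-length : ∀ {t} → a ≼ t → length (unsupported t) ≤ k
      unsupported-length {t} a≼t = ≤-trans (unique-⊆⇒length-≤ (unsupported-unique t)
        (chosen⊆active a≼t ∘ proj₁ ∘ ∈-filter⁻ (unsupported? t))) (active-length t)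

      potential-bound : potential a ≤ suc k * k + k
      potential-bound = +-mono-≤ (*-monoʳ-≤ (suc k) (≤-trans (length-filter (alive? a) (allFin (pieces a)))
        (≤-trans (≤-reflexive (length-tabulate id)) (pieces≤k a)))) (unsupported-length ≼-refl)

      module _ {t n} (eq : depth t ≡ suc n) (a≼s : a ≼ par t) where

        private
          s = par t
          a≼t : a ≼ t
          a≼t = ≼-step eq a≼s

        alive-mono : ∀ {i} → Alive t i → Alive s i
        alive-mono (q , q∈i , q∈t) = q , q∈i , bag-convex a≼s (≼-step eq ≼-refl) (piece⇒bag q∈i) q∈t

        alive-⊆ : alive t ⊆ alive s
        alive-⊆ i∈ = ∈-filter⁺ (alive? s) (∈-allFin _)
          (alive-mono (proj₂ (∈-filter⁻ (alive? t) {xs = allFin _} i∈)))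

        touches-mono : ∀ {P} → P ∈ candidates a → Touches t P → Touches s P
        touches-mono P∈ (p , p∈P , p∈t) =
          p , p∈P , bag-convex (≼-trans (candidates-≼ P∈) a≼s) (≼-step eq ≼-refl) (piece⇒bag p∈P) p∈t

        -- The common point lies in a bag above `a` and in the bag at `t`, so by convexity it lies
        -- in the bag at `a` and in one of its pieces.
        touches⇒supported : ∀ {P} → P ∈ candidates a → Touches t P → Supported t P
        touches⇒supported P∈ (p , p∈P , p∈t)
          with i , p∈i ← bag⇒piece (bag-convex (candidates-≼ P∈) a≼t (piece⇒bag p∈P) p∈t) =
          i , (p , p∈i , p∈t) , p , p∈P , p∈i

        Unchanged : Set
        Unchanged = chosen a t ≡ chosen a s × potential t ≤ potential s

        drop-alive : ∀ {i} → Alive s i → ¬ Alive t i → potential t < potential s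
        drop-alive {i} is it = ≤-trans (s≤s (+-monoʳ-≤ (suc k * length (alive t)) (unsupported-length a≼t)))
          (≤-trans (≤-reflexive arithmetic) (≤-trans (*-monoʳ-≤ (suc k) fewer) (m≤m+n _ _)))
          where
          fewer : length (alive t) < length (alive s)
          fewer = unique-⊂⇒length-< (alive-unique t) alive-⊆
            (∈-filter⁺ (alive? s) (∈-allFin i) is)
            (λ i∈ → it (proj₂ (∈-filter⁻ (alive? t) {xs = allFin _} i∈)))
          arithmetic : suc (suc k * length (alive t) + k) ≡ suc k * suc (length (alive t))
          arithmetic = trans (cong suc (+-comm _ k)) (sym (*-suc (suc k) (length (alive t))))

        module _ (alive-same : ∀ {i} → Alive s i → Alive t i) where

          -- An unsupported piece does not touch the bag, so it is inherited and was chosen at `s`;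
          -- support at `s` would have persisted.
          unsupported-mono : unsupported t ⊆ unsupported s
          unsupported-mono P∈ with P∈t , ¬supported ← ∈-filter⁻ (unsupported? t) {xs = chosen a t} P∈
            with greedy-eligible _ (candidates a) P∈t
          ... | inj₁ touches = contradiction (touches⇒supported (greedy⊆ _ (candidates a) P∈t) touches) ¬supported
          ... | inj₂ (P∈s , _) = ∈-filter⁺ (unsupported? s)
            (active∩candidates⊆chosen a≼s (subst (_ ∈_) (inherited-suc eq) P∈s) (greedy⊆ _ (candidates a) P∈t))
            λ (i , alive , rest) → ¬supported (i , alive-same alive , rest)

          alive-length : length (alive t) ≤ length (alive s)
          alive-length = unique-⊆⇒length-≤ (alive-unique t) alive-⊆

          -- Such a P was unsupported at `s`, for otherwise it would still be supported and hover at
          -- `t`.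
          drop-unsupported : ∀ {P} → P ∈ chosen a s → ¬ Hovers t P → potential t < potential s
          drop-unsupported {P} P∈ ¬hovers = +-mono-≤-< (*-monoʳ-≤ (suc k) alive-length)
            (unique-⊂⇒length-< (unsupported-unique t) unsupported-mono
              (∈-filter⁺ (unsupported? s) P∈ λ (i , alive , rest) →
                ¬hovers (supported⇒hovers (i , alive-same alive , rest)))
              (λ P∈t → ¬hovers (eligible⇒hovers (greedy-eligible _ (candidates a)
                (proj₁ (∈-filter⁻ (unsupported? t) {xs = chosen a t} P∈t))))))

          -- By `greedy-cong`: chosen pieces are inherited and still hover, and a candidate of `a`
          -- eligible at `t` touches the bag at `s` or was active there.
          unchanged : (∀ {P} → P ∈ chosen a s → Hovers t P) → Unchanged
          unchanged hovers =
            greedy-cong (candidates a)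
              (λ P∈ → inj₂ (subst (_ ∈_) (sym (inherited-suc eq)) (chosen⊆active a≼s P∈) , hovers P∈))
              (λ P∈a → [ inj₁ ∘ touches-mono P∈a
                       , active-eligible ∘ subst (_ ∈_) (inherited-suc eq) ∘ proj₁ ]′)
            , +-mono-≤ (*-monoʳ-≤ (suc k) alive-length)
                       (unique-⊆⇒length-≤ (unsupported-unique t) unsupported-mono)

        potential-step : potential t < potential s ⊎ Unchanged
        potential-step with em {∃[ i ] (Alive s i × ¬ Alive t i)}
        ... | yes (i , is , it) = inj₁ (drop-alive is it)
        ... | no none with em {∃[ P ] (P ∈ chosen a s × ¬ Hovers t P)}
        ...   | yes (P , P∈ , ¬hovers) =
          inj₁ (drop-unsupported (λ is → decidable-stable em λ it → none (_ , is , it)) P∈ ¬hovers)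
        ...   | no none′ =
          inj₂ (unchanged (λ is → decidable-stable em λ it → none (_ , is , it))
                          (λ P∈ → decidable-stable em λ ¬h → none′ (_ , P∈ , ¬h)))

    -- A piece that becomes active again gets a new label, because the nodes whose bags contain a
    -- given label must form a subtree.

    Label : Set
    Label = Piece × V T

    startStep : ∀ t {P} → Dec (P ∈ inherited t) → (Piece → V T) → V T
    startStep t {P} (yes _) f = f P
    startStep t     (no _)  f = t

    -- A default value: nothing is inherited at the root, so every start there is the root itself.
    initial : Piece → V T
    initial _ = root

    restart : V T → (Piece → V T) → Piece → V T
    restart t f P = startStep t {P} em f

    start : V T → Piece → V T
    start = descend initial restart

    label : V T → Piece → Label
    label t P = P , start t P

    start-step : ∀ t P → start t P ≡ restart t (atParent initial start t) P
    start-step t P = cong (λ f → f P) (descend-step initial restart t)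

    start-new : ∀ {t P} → P ∉ inherited t → start t P ≡ t
    start-new {t} {P} P∉ = trans (start-step t P) (new em)
      where
      new : (P∈? : Dec (P ∈ inherited t)) → startStep t P∈? (atParent initial start t) ≡ t
      new (yes P∈) = contradiction P∈ P∉
      new (no _)   = refl

    start-keep : ∀ {t n P} → depth t ≡ suc n → P ∈ active (par t) → start t P ≡ start (par t) P
    start-keep {t} {P = P} eq P∈ =
      trans (start-step t P) (trans (keep em) (cong (λ f → f P) (atParent-suc initial {f = start} eq)))
      where
      keep : (P∈? : Dec (P ∈ inherited t)) →
             startStep t P∈? (atParent initial start t) ≡ atParent initial start t P
      keep (yes _)  = refl
      keep (no P∉) = contradiction (subst (P ∈_) (sym (inherited-suc eq)) P∈) P∉

    label-keep : ∀ {t n P} → depth t ≡ suc n → P ∈ active (par t) → label t P ≡ label (par t) P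
    label-keep eq P∈ = cong (_ ,_) (start-keep eq P∈)

    labels : V T → List Label
    labels t = map (label t) (active t)

    label∈ : ∀ {t P} → P ∈ active t → label t P ∈ labels t
    label∈ = ∈-map⁺ (label _)

    labels-unique : ∀ t → Unique (labels t)
    labels-unique t = Unique.map⁺ (cong proj₁) (active-unique t)

    labels-length : ∀ t → length (labels t) ≤ k
    labels-length t = ≤-trans (≤-reflexive (length-map (label t) (active t))) (active-length t)

    Match Close : Rel Label 0ℓ
    Match (P , _) (Q , _) = Distance≤ match-distance P Q
    Close (P , _) (Q , _) = Distance≤ close-distance P Q

    match⇒close : ∀ {x y} → Match x y → Close x y
    match⇒close {P , _} {Q , _} = distance-mono {P = P} {Q}
      (≤-trans (m≤m+n match-distance r) (m≤m+n (match-distance + r) match-distance))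

    close-sym : Symmetric Close
    close-sym {P , _} {Q , _} = distance-sym {x = P} {Q}

    module A = Assembly em rooting labels labels-unique k labels-length Close Match
      (λ {x} {y} → close-sym {x} {y}) (λ {x} {y} → match⇒close {x} {y})

    piece∈active : ∀ {t x} → x ∈ labels t → proj₁ x ∈ active t
    piece∈active {t} x∈ with _ , P∈ , refl ← ∈-map⁻ (label t) x∈ = P∈

    piece∈inherited : ∀ {t x} → x ∈ A.previous t → proj₁ x ∈ inherited t
    piece∈inherited x∈ with n , eq , x∈s ← A.∈previous x∈ =
      subst (_ ∈_) (sym (inherited-suc eq)) (piece∈active x∈s)

    ∈previous⁺ : ∀ {t n P} → depth t ≡ suc n → P ∈ active (par t) → label (par t) P ∈ A.previous t
    ∈previous⁺ {t} {P = P} eq P∈ =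
      subst (label (par t) P ∈_) (sym (atParent-suc [] {f = labels} eq)) (label∈ P∈)

    label-born : ∀ {t x} → x ∈ labels t → x ∉ A.previous t → proj₂ x ≡ t
    label-born {t} x∈ x∉ with P , P∈ , refl ← ∈-map⁻ (label t) x∈ = start-new λ P∈s →
      let n , eq , P∈par = ∈inherited P∈s
      in x∉ (subst (_∈ A.previous t) (sym (label-keep eq P∈par)) (∈previous⁺ eq P∈par))

    open A.WithBirth proj₂ label-born public
      using (Vertex; H; vertex; near-target; near-exchange; decomposition; width)

    match-near : ∀ {P Q v σ τ} → NearPiece P v → NearPiece Q v → Match (P , σ) (Q , τ)
    match-near (p , p∈ , p-v) (q , q∈ , q-v) =
      p , q , p∈ , q∈ , near-mono G (n≤1+n _) (near-trans G p-v (near-sym G q-v))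

    close-near : ∀ {P Q v} x y → proj₁ x ≡ P → proj₁ y ≡ Q → NearPiece P v → NearPiece Q v → Close x y
    close-near x y refl refl near near′ =
      match⇒close {x} {y} (match-near {σ = proj₂ x} {proj₂ y} near near′)

    match-match : ∀ {x y z} → Match x y → Match y z → Close x z
    match-match (p , q , p∈ , q∈ , p-q) (q′ , s , q′∈ , s∈ , q′-s) =
      p , s , p∈ , s∈ , near-trans G (near-trans G p-q (piece-near q∈ q′∈)) q′-s

    match-sym : ∀ {x y} → Match x y → Match y x
    match-sym {P , _} {Q , _} = distance-sym {x = P} {Q}

    ∈labels : ∀ {t P} (x : Vertex) → value x ≡ label t P → P ∈ active t → value x ∈ labels t
    ∈labels x eq P∈ = subst (_∈ labels _) (sym eq) (label∈ P∈)

    near-active : ∀ {t P Q v} (x y : Vertex) → value x ≡ label t P → value y ≡ label t Q →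
                  P ∈ active t → Q ∈ active t → NearPiece P v → NearPiece Q v → Near H 1 x y
    near-active x y x≡ y≡ P∈ Q∈ P-v Q-v = near-target {x = x} {y} (∈labels x x≡ P∈) (∈labels y y≡ Q∈)
      (close-near (value x) (value y) (cong proj₁ x≡) (cong proj₁ y≡) P-v Q-v)

    -- If one of the two labels is common to both nodes, they share a target. Otherwise P departs
    -- and Q arrives, and being near v they match.
    near-step : ∀ {t n P Q v} → depth t ≡ suc n → (x y : Vertex) →
                value x ≡ label t Q → value y ≡ label (par t) P →
                Q ∈ active t → P ∈ active (par t) → NearPiece Q v → NearPiece P v → Near H 2 x y
    near-step {t} {P = P} {Q} eq x y x≡ y≡ Q∈ P∈ Q-v P-v = go em em
      where
      go : Dec (P ∈ active t) → Dec (Q ∈ active (par t)) → Near H 2 x y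
      go (yes P∈t) _ = near-mono H (s≤s z≤n)
        (near-active x y x≡ (trans y≡ (sym (label-keep eq P∈))) Q∈ P∈t Q-v P-v)
      go (no _) (yes Q∈s) = near-mono H (s≤s z≤n)
        (near-active x y (trans x≡ (label-keep eq Q∈s)) y≡ Q∈s P∈ Q-v P-v)
      go (no P∉t) (no Q∉s) = near-sym H (near-exchange
        (λ {x} {y} → match-sym {x} {y}) (λ {x} {y} {z} → match-match {x} {y} {z}) y x
        (subst (_∈ A.previous t) (sym y≡) (∈previous⁺ eq P∈))
        (λ y∈ → P∉t (subst (_∈ active t) (cong proj₁ y≡) (piece∈active y∈)))
        (∈labels x x≡ Q∈)
        (λ x∈ → Q∉s (subst₂ _∈_ (cong proj₁ x≡) (inherited-suc eq) (piece∈inherited x∈)))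
        (subst₂ Match (sym y≡) (sym x≡) (match-near {σ = start (par t) P} {start t Q} P-v Q-v)))

    -- The map to the new graph and its distance bounds.

    top : V G → V T
    top v = proj₁ (highest v)

    ∈top : ∀ v → bag (top v) v
    ∈top v = proj₁ (proj₂ (highest v))

    nearest : V G → Piece
    nearest v = proj₁ (cover-active (∈top v))

    nearest∈ : ∀ v → nearest v ∈ active (top v)
    nearest∈ v = proj₁ (proj₂ (cover-active (∈top v)))

    nearest-near : ∀ v → NearPiece (nearest v) v
    nearest-near v = proj₂ (proj₂ (cover-active (∈top v)))

    φ : V G → Vertex
    φ v = vertex (label∈ (nearest∈ v))

    module _ (v : V G) where
      open Potential (top v)

      -- Here `e` counts the drops of the potential on the way down from `top v`; each costs one
      -- `near-step`.
      Tracked : V T → Set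
      Tracked t = ∃[ e ] (e + potential t ≤ potential (top v) ×
        (∀ {P} → P ∈ chosen (top v) t → NearPiece P v →
         (x : Vertex) → value x ≡ label t P → Near H (1 + e * 2) x (φ v)))

      track-step : ∀ {t n} (eq : depth t ≡ suc n) (a≼s : top v ≼ par t) → bag (par t) v →
                   Tracked (par t) → potential t < potential (par t) ⊎ Unchanged eq a≼s → Tracked t
      track-step {t} eq a≼s v∈s (e , e≤ , near) (inj₂ (same , ≤s)) =
        e , ≤-trans (+-monoʳ-≤ e ≤s) e≤ , λ {P} P∈ P-v x x≡ →
          let P∈s = subst (P ∈_) same P∈
          in near P∈s P-v x (trans x≡ (label-keep eq (chosen⊆active a≼s P∈s)))
      track-step {t} eq a≼s v∈s (e , e≤ , near) (inj₁ <s) =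
        suc e , ≤-trans (≤-trans (≤-reflexive (sym (+-suc e (potential t)))) (+-monoʳ-≤ e <s)) e≤ ,
        λ P∈ P-v x x≡ →
          -- A piece chosen at the parent and near v serves as the intermediate stop.
          let Q , Q∈ , Q-v = cover (∈top v) v∈s
              Q∈s = chosen⊆active a≼s Q∈
              y = vertex (label∈ Q∈s)
          in near-trans H {m = 2} {n = 1 + e * 2} {v = y}
               (near-step eq x y x≡ refl (chosen⊆active (≼-step eq a≼s) P∈) Q∈s P-v Q-v)
               (near Q∈ Q-v y refl)

      track : ∀ {t} → top v ≼ t → bag t v → Tracked t
      track ≼-refl _ = 0 , ≤-refl , λ P∈ P-v x x≡ →
        near-active x (φ v) x≡ refl (chosen⊆active ≼-refl P∈) (nearest∈ v) P-v (nearest-near v)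
      track (≼-step eq a≼s) v∈t =
        track-step eq a≼s v∈s (track a≼s v∈s) (potential-step eq a≼s)
        where v∈s = bag-convex a≼s (≼-step eq ≼-refl) (∈top v) v∈t

      -- P may stem from below `top v`, but it shares the target at `t` with a tracked piece near v,
      -- hence one more edge.
      track-active : ∀ {t P} → bag t v → P ∈ active t → NearPiece P v →
                     (x : Vertex) → value x ≡ label t P → Near H spread x (φ v)
      track-active v∈t P∈ P-v x x≡ =
        let top≼t         = proj₂ (proj₂ (highest v)) v∈t
            e , e≤ , near = track top≼t v∈t
            Q , Q∈ , Q-v  = cover (∈top v) v∈t
            Q∈t           = chosen⊆active top≼t Q∈
            y             = vertex (label∈ Q∈t)
        in near-trans H {m = 1} {v = y} (near-active x y x≡ refl P∈ Q∈t P-v Q-v)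
             (near-mono H (s≤s (*-monoˡ-≤ 2 (≤-trans (m+n≤o⇒m≤o e e≤) potential-bound)))
               (near Q∈ Q-v y refl))

    match-adjacent : ∀ {u v P Q σ τ} → Adj G u v → NearPiece P u → NearPiece Q v → Match (P , σ) (Q , τ)
    match-adjacent e (p , p∈ , p-u) (q , q∈ , q-v) = p , q , p∈ , q∈ ,
      near-mono G (≤-reflexive sum≡)
        (near-trans G (near-trans G p-u (near-edge G e)) (near-sym G q-v))
      where
      sum≡ : near-radius + 1 + near-radius ≡ match-distance
      sum≡ = trans (+-assoc near-radius 1 near-radius) (+-suc near-radius near-radius)

    φ-edge : ∀ {u v} → Adj G u v → Near H edge-length (φ u) (φ v)
    φ-edge {u} {v} e =
      let t , u∈t , v∈t = coversE e
          P , P∈ , P-u  = cover-active u∈t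
          Q , Q∈ , Q-v  = cover-active v∈t
          x = vertex (label∈ P∈)
          y = vertex (label∈ Q∈)
      in near-trans H {m = spread + 1} {n = spread} {v = y}
           (near-trans H {m = spread} {n = 1} {v = x}
             (near-sym H (track-active u u∈t P∈ P-u x refl))
             (near-target {x = x} {y} (label∈ P∈) (label∈ Q∈)
               (match⇒close {value x} {value y} (match-adjacent {σ = start t P} {start t Q} e P-u Q-v))))
           (track-active v v∈t Q∈ Q-v y refl)

    φ-upper : ∀ {u v} (p : Walk G u v) → Near H (walkLength G p * edge-length) (φ u) (φ v)
    φ-upper ε       = near-refl H
    φ-upper (e ◅ p) = near-trans H (φ-edge e) (φ-upper p)

    -- Each edge bridges `close-distance`, and each piece on the way is crossed at cost r.
    walk-lower : ∀ {x y} (w : Walk H x y) {p q} → member (proj₁ (value x)) p → member (proj₁ (value y)) q →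
                 Near G (r + walkLength H w * (close-distance + r)) p q
    walk-lower ε p∈ q∈ = near-mono G (m≤m+n r 0) (piece-near p∈ q∈)
    walk-lower ((_ , (p′ , z , p′∈ , z∈ , p′-z) , _) ◅ w) p∈ q∈ =
      near-mono G (≤-reflexive sum≡) (near-trans G (near-trans G (piece-near p∈ p′∈) p′-z) (walk-lower w z∈ q∈))
      where
      n = walkLength H w * (close-distance + r)
      sum≡ : r + close-distance + (r + n) ≡ r + (close-distance + r + n)
      sum≡ = trans (+-assoc r close-distance (r + n)) (cong (r +_) (sym (+-assoc close-distance r n)))

    φ-lower : ∀ {u v} (w : Walk H (φ u) (φ v)) →
              Near G (near-radius + (r + walkLength H w * (close-distance + r)) + near-radius) u v
    φ-lower {u} {v} w =
      let p , p∈ , p-u = nearest-near u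
          q , q∈ , q-v = nearest-near v
      in near-trans G (near-trans G (near-sym G p-u) (walk-lower w p∈ q∈)) q-v

    -- A piece becomes active only by touching the bag, so going up while it is inherited ends at a
    -- node where it touches. Its point there is the preimage used in `φ-dense`.
    touching : ∀ n {t P} → depth t ≡ n → P ∈ active t →
               ∃[ s ] (label t P ≡ label s P × P ∈ active s × Touches s P)
    touching n {t} {P} eq P∈ = go n eq (active-eligible P∈)
      where
      go : ∀ n → depth t ≡ n → Eligible t (inherited t) P →
           ∃[ s ] (label t P ≡ label s P × P ∈ active s × Touches s P)
      go n       eq (inj₁ touches)   = t , refl , P∈ , touches
      go zero    eq (inj₂ (P∈s , _)) =
        let m , eq′ , _ = ∈inherited P∈s in contradiction (trans (sym eq) eq′) λ()
      go (suc n) eq (inj₂ (P∈s , _)) =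
        let P∈par        = subst (P ∈_) (inherited-suc eq) P∈s
            s , t≡s , rest = touching n (trans (depth-par t) (cong pred eq)) P∈par
        in s , trans (label-keep eq P∈par) t≡s , rest

    ∈labels⁻ : ∀ {t x} → x ∈ labels t → ∃[ P ] (P ∈ active t × x ≡ label t P)
    ∈labels⁻ {t} = ∈-map⁻ (label t)

    φ-dense : ∀ y → ∃[ v ] Near H spread (φ v) y
    φ-dense y@(_ , [ alive ]) =
      let t , y∈                       = recompute em alive
          P , P∈t , y≡                 = ∈labels⁻ y∈
          s , t≡s , P∈ , p , p∈P , p∈s = touching _ refl P∈t
      in p , near-sym H (track-active p p∈s P∈ (p , p∈P , near-refl G) y (trans y≡ t≡s))

open import Relation.Unary using (_∈_)

-- Distances and walks of bounded length.

module Distance (em : ExcludedMiddle 0ℓ) where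
  open Classical em

  -- The pruned path is replaced by a shorter one as long as there is one; `m` bounds the number of
  -- replacements.
  near⇒dist : ∀ G {m u v} → Near G m u v → ∃[ n ] (n ℕ.≤ m × IsDist G u v n)
  near⇒dist G {m} {u} {v} (p , p≤m) with q , q-path , _ , q≤p ← prune G p =
    go m q q-path (ℕ.≤-trans q≤p p≤m)
    where
    go : ∀ m (q : Walk G u v) → IsPath G q → walkLength G q ℕ.≤ m →
         ∃[ n ] (n ℕ.≤ m × IsDist G u v n)
    go m q q-path q≤m with em {Σ[ r ∈ Walk G u v ] (IsPath G r × walkLength G r ℕ.< walkLength G q)}
    ... | no minimal = walkLength G q , q≤m , (q , q-path , refl) ,
            λ r r-path → ℕ.≮⇒≥ λ r<q → minimal (r , r-path , r<q)
    go zero    q _ q≤m | yes (_ , _ , r<q) = contradiction (ℕ.≤-trans r<q q≤m) λ()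
    go (suc m) q _ q≤m | yes (r , r-path , r<q)
      with n , n≤m , dist ← go m r r-path (ℕ.≤-pred (ℕ.≤-trans r<q q≤m)) =
      n , ℕ.m≤n⇒m≤1+n n≤m , dist

  dist⇒near : ∀ G {u v n} → IsDist G u v n → Near G n u v
  dist⇒near G ((p , _ , refl) , _) = p , ℕ.≤-refl

  module _ (ℝ : RealField) where
    open Reals ℝ

    near⇒distAtMost : ∀ G {m u v x} → fromℕ m ≤ x → Near G m u v → DistAtMost ℝ G u v x
    near⇒distAtMost G m≤x near with n , n≤m , dist ← near⇒dist G near =
      n , dist , ≤-trans (fromℕ-mono n≤m) m≤x

    distAtMost-mono : ∀ G {u v x y} → x ≤ y → DistAtMost ℝ G u v x → DistAtMost ℝ G u v y
    distAtMost-mono G x≤y (n , dist , n≤x) = n , dist , ≤-trans n≤x x≤y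

-- Part (b): pulling the decomposition back along the quasi-isometry.

module PullBack (em : ExcludedMiddle 0ℓ) (ℝ : RealField) {k : ℕ} {L C : RealField.Carrier ℝ}
  (1≤L : RealField._≤_ ℝ (RealField.1# ℝ) L) (1≤C : RealField._≤_ ℝ (RealField.1# ℝ) C)
  {G H : Graph} (D : PseudoTreeDecomposition H) (width : WidthAtMost D k)
  (φ : V G → V H) (qi : IsQuasiIsometry ℝ L C G H φ) where

  open Reals ℝ
  open Classical em
  open Distance em
  open PseudoTreeDecomposition D
  open IsQuasiIsometry qi

  0≤L : 0# ≤ L
  0≤L = ≤-trans 0≤1 1≤L

  0≤L+C : 0# ≤ L + C
  0≤L+C = +-nonNeg 0≤L (≤-trans 0≤1 1≤C)

  Reaches : V G → V H → Set
  Reaches v h = Σ[ p ∈ Walk H (φ v) h ] fromℕ (walkLength H p) ≤ L + C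

  bag⁺ : V T → Pred (V G) 0ℓ
  bag⁺ t v = ∃[ h ] (h ∈ bag t × Reaches v h)

  WithinBags : V G → V T → V T → Set
  WithinBags v = Within T (λ t → v ∈ bag⁺ t)

  same-vertex : ∀ {v h s t} → Reaches v h → h ∈ bag s → h ∈ bag t → WithinBags v s t
  same-vertex {s = s} {t} reach h∈s h∈t with p , path ← IsTree.connected isTree s t =
    p , λ u∈p → _ , interpolates p path u∈p h∈s h∈t , reach

  -- Follows the walk to h, whose vertices are all reached by v. An edge inside a bag keeps to the
  -- bags of its ends, and an exchange edge is crossed along the corresponding edge of `T`.
  connect : ∀ {v x h} (p : Walk H (φ v) x) (q : Walk H x h) →
            fromℕ (walkLength H p ℕ.+ walkLength H q) ≤ L + C →
            ∀ {s t} → x ∈ bag s → h ∈ bag t → WithinBags v s t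
  connect p ε bound x∈s h∈t =
    same-vertex (p , fromℕ-prefix (walkLength H p) 0 bound) x∈s h∈t
  connect {v} {x} p (_◅_ {j = y} e q) bound {s} {t} x∈s h∈t = step (coversE e)
    where
    p⁺ : Walk H (φ v) y
    p⁺ = p ◅◅ e ◅ ε

    bound⁺ : fromℕ (walkLength H p⁺ ℕ.+ walkLength H q) ≤ L + C
    bound⁺ = ≤-trans (fromℕ-mono (ℕ.≤-reflexive
      (trans (cong (ℕ._+ walkLength H q) (length-◅◅ H p (e ◅ ε)))
             (ℕ.+-assoc (walkLength H p) 1 (walkLength H q))))) bound

    reach : Reaches v x
    reach = p , fromℕ-prefix (walkLength H p) _ bound

    reach⁺ : Reaches v y
    reach⁺ = p⁺ , fromℕ-prefix (walkLength H p⁺) (walkLength H q) bound⁺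

    step : _ → WithinBags v s t
    step (inj₁ (s′ , x∈s′ , y∈s′)) = 
      within-trans T (same-vertex reach x∈s x∈s′) (connect p⁺ q bound⁺ y∈s′ h∈t)
    step (inj₂ (s₁ , s₂ , e′ , (_ , x⊆) , (_ , y⊆))) =
      within-trans T (same-vertex reach x∈s x∈s₁)
        (within-step T e′ (x , x∈s₁ , reach) (connect p⁺ q bound⁺ y∈s₂ h∈t))
      where
      x∈s₁ = proj₁ (x⊆ refl)
      y∈s₂ = proj₁ (y⊆ refl)

  -- Adjacent vertices have images at distance at most L·1 + C, whence the radius. So both ends of
  -- an edge lie in `bag⁺ t` whenever `bag t` contains the image of one of them.
  adjacent-reach : ∀ {u v} → Adj G u v → Reaches u (φ v)
  adjacent-reach {u} {v} e
    with d , d≤1 , dist ← near⇒dist G (near-edge G e)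
    with n , distH , n≤ ← upper u v d dist
    with p , p≤n ← dist⇒near H distH =
    p , ≤-trans (fromℕ-mono p≤n) (≤-trans n≤ (+-monoˡ-≤ C
      (≤-trans (*-monoʳ-≤ 0≤L (fromℕ-mono d≤1))
        (≤-reflexive (≈-trans (*-cong ≈-refl (+-identityʳ 1#)) (*-identityʳ L))))))

  bag⁺-interpolates : Interpolates G T bag⁺
  bag⁺-interpolates p path t₂∈p {v} (h₁ , h₁∈ , p₁ , len₁) (h₃ , h₃∈ , p₃ , len₃)
    with t , φv∈ ← coversV (φ v)
    = Tree.path-within isTree p path (within-trans T
        (within-sym T (connect {v} ε p₁ len₁ φv∈ h₁∈)) (connect {v} ε p₃ len₃ φv∈ h₃∈)) t₂∈p

  treeDecomposition : TreeDecomposition G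
  treeDecomposition = record
    { T            = T
    ; isTree       = isTree
    ; bag          = bag⁺
    ; coversV      = λ v → let t , φv∈ = coversV (φ v) in t , φ v , φv∈ , ε , 0≤L+C
    ; coversE      = λ {u} {v} e → let t , φv∈ = coversV (φ v) in
                       t , (φ v , φv∈ , adjacent-reach e) , (φ v , φv∈ , ε , 0≤L+C)
    ; interpolates = bag⁺-interpolates
    }

  -- Two images are at most 2(L + C) apart through h, and `lower` carries this over to `G`.
  ball-diameter : ∀ h → DiameterAtMost ℝ G (λ v → Reaches v h) (fromℕ 2 * L * (L + C) + C)
  ball-diameter h u v (p , p≤) (q , q≤)
    with d , d≤ , dist ← near⇒dist H (near-trans H (p , ℕ.≤-refl) (near-sym H (q , ℕ.≤-refl)))
    = distAtMost-mono ℝ G (+-monoˡ-≤ C (≤-trans (*-monoʳ-≤ 0≤L d≤2[L+C])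
        (≤-reflexive (≈-trans (≈-sym (*-assoc L (fromℕ 2) (L + C)))
                              (*-cong (*-comm L (fromℕ 2)) ≈-refl)))))
        (lower u v d dist)
    where
    d≤2[L+C] : fromℕ d ≤ fromℕ 2 * (L + C)
    d≤2[L+C] = ≤-trans (fromℕ-mono d≤) (≤-trans (≤-reflexive (fromℕ-+ (walkLength H p) _))
      (≤-trans (+-mono-≤ p≤ q≤) (≤-reflexive (≈-sym (fromℕ-2* (L + C))))))

  bag⁺-bounded : ∀ t → UnionOfBoundedSets ℝ G k (fromℕ 2 * L * (L + C) + C) (bag⁺ t)
  bag⁺-bounded t with n , (hs , _ , hs⇔ , refl) , n≤k ← width t =
    n , n≤k , (λ i v → Reaches v (lookup hs i)) , (to , from) , λ i → ball-diameter (lookup hs i)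
    where
    to : ∀ {v} → v ∈ bag⁺ t → ∃[ i ] Reaches v (lookup hs i)
    to {v} (h , h∈ , reach) = let h∈hs = Equivalence.from (hs⇔ h) h∈ in
      index h∈hs , subst (Reaches v) (lookup-index h∈hs) reach
    from : ∀ {v} → ∃[ i ] Reaches v (lookup hs i) → v ∈ bag⁺ t
    from (i , reach) = lookup hs i , Equivalence.to (hs⇔ _) (∈-lookup i) , reach

-- Part (a): the constants of the quasi-isometry.

module PushForward (em : ExcludedMiddle 0ℓ) (ℝ : RealField) (k : ℕ) (r : RealField.Carrier ℝ) where
  open Reals ℝ
  open Distance em

  radius : ℕ
  radius = proj₁ (archimedean em r)

  open Constants k radius

  -- Sums dominate both summands: the first ones come from `φ-upper` and `φ-dense`, the second ones
  -- from `φ-lower`.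
  slope offset : ℕ
  slope  = edge-length ℕ.+ (close-distance ℕ.+ radius)
  offset = spread ℕ.+ (near-radius ℕ.+ radius ℕ.+ near-radius)

  module _ {G : Graph} (D : TreeDecomposition G)
    (bounded : ∀ t → UnionOfBoundedSets ℝ G k r (TreeDecomposition.bag D t)) where

    private
      diameter-near : ∀ {X : Pred (V G) 0ℓ} {u v} → DiameterAtMost ℝ G X r → X u → X v → Near G radius u v
      diameter-near diam u∈ v∈ with n , dist , n≤r ← diam _ _ u∈ v∈ =
        near-mono G (fromℕ-cancel-≤ (≤-trans n≤r (proj₂ (archimedean em r)))) (dist⇒near G dist)

    open Contraction em D (rooted em (TreeDecomposition.isTree D)) k radius
      (λ t → proj₁ (bounded t)) (λ t → proj₁ (proj₂ (bounded t)))
      (λ t → proj₁ (proj₂ (proj₂ (bounded t))))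
      (λ {t} → proj₁ (proj₁ (proj₂ (proj₂ (proj₂ (bounded t))))))
      (λ {t} v∈ → proj₂ (proj₁ (proj₂ (proj₂ (proj₂ (bounded t))))) (_ , v∈))
      (λ {t} → diameter-near (proj₂ (proj₂ (proj₂ (proj₂ (bounded t)))) _))

    narrow : PseudoTreeWidthAtMost H k
    narrow = decomposition , width

    affine-bound : ∀ {m} d → m ℕ.≤ slope ℕ.* d ℕ.+ offset →
                   fromℕ m ≤ fromℕ slope * fromℕ d + fromℕ offset
    affine-bound d m≤ = ≤-trans (fromℕ-mono m≤) (≤-reflexive (fromℕ-affine slope d offset))

    upper-bound : ∀ d → d ℕ.* edge-length ℕ.≤ slope ℕ.* d ℕ.+ offset
    upper-bound d = ℕ.≤-trans (ℕ.≤-reflexive (ℕ.*-comm d edge-length))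
      (ℕ.≤-trans (ℕ.*-monoˡ-≤ d (ℕ.m≤m+n edge-length _)) (ℕ.m≤m+n (slope ℕ.* d) offset))

    lower-bound : ∀ d → near-radius ℕ.+ (radius ℕ.+ d ℕ.* (close-distance ℕ.+ radius)) ℕ.+ near-radius
                        ℕ.≤ slope ℕ.* d ℕ.+ offset
    lower-bound d = ℕ.≤-trans (ℕ.≤-reflexive (rearrange near-radius radius d (close-distance ℕ.+ radius)))
      (ℕ.+-mono-≤ (ℕ.*-monoˡ-≤ d (ℕ.m≤n+m _ edge-length)) (ℕ.m≤n+m _ spread))
      where
      rearrange : ∀ a b d s → a ℕ.+ (b ℕ.+ d ℕ.* s) ℕ.+ a ≡ s ℕ.* d ℕ.+ (a ℕ.+ b ℕ.+ a)
      rearrange = solve-∀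

    isQuasiIsometry : IsQuasiIsometry ℝ (fromℕ slope) (fromℕ offset) G H φ
    isQuasiIsometry = record
      { upper = λ where u v d ((p , _ , refl) , _) →
                          near⇒distAtMost ℝ H (affine-bound d (upper-bound d)) (φ-upper p)
      ; lower = λ where u v d ((p , _ , refl) , _) →
                          near⇒distAtMost ℝ G (affine-bound d (lower-bound d)) (φ-lower p)
      ; dense = λ y → let v , near = φ-dense y in
                      v , near⇒distAtMost ℝ H (fromℕ-mono (ℕ.m≤m+n spread _)) near
      }

    quasiIsometric : Σ[ H ∈ Graph ] (PseudoTreeWidthAtMost H k ×
                                     AdmitsQuasiIsometry ℝ (fromℕ slope) (fromℕ offset) G H)
    quasiIsometric = H , narrow , φ , isQuasiIsometry

mainTheorem3 : ExcludedMiddle 0ℓ → Extensionality 0ℓ 0ℓ →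
    (ℝ : RealField) → let open RealField ℝ in
    ((k : ℕ) (r : Carrier) → 0# ≤ r →
    ∃[ L ] ∃[ C ] (0# ≤ L × 0# ≤ C ×
    ((G : Graph) →
    (Σ[ D ∈ TreeDecomposition G ] (let open TreeDecomposition D in
    ∀ t → UnionOfBoundedSets ℝ G k r (bag t))) →
    Σ[ H ∈ Graph ] (PseudoTreeWidthAtMost H k × AdmitsQuasiIsometry ℝ L C G H))))
    ×
    ((k : ℕ) (L C : Carrier) → 1# ≤ L → 1# ≤ C →
    (G : Graph) →
    (Σ[ H ∈ Graph ] (PseudoTreeWidthAtMost H k × AdmitsQuasiIsometry ℝ L C G H)) →
    Σ[ D ∈ TreeDecomposition G ] (let open TreeDecomposition D in
    ∀ t → UnionOfBoundedSets ℝ G k (fromℕ 2 * L * (L + C) + C) (bag t)))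
mainTheorem3 em _ ℝ = part-a , part-b
  where
  part-a = λ k r _ →
    let open PushForward em ℝ k r
        open Reals ℝ using (fromℕ; fromℕ-nonNeg)
    in fromℕ slope , fromℕ offset , fromℕ-nonNeg slope , fromℕ-nonNeg offset ,
       λ G (D , bounded) → quasiIsometric D bounded
  part-b = λ k L C 1≤L 1≤C G (H , (D , width) , φ , qi) →
    let open PullBack em ℝ 1≤L 1≤C D width φ qi
    in treeDecomposition , bag⁺-bounded
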